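{- Given $c>0$, $\kappa\ge1$, and $0<\rho\le1$, let $G_{\mathcal C}=(\mathcal C,E_{\mathcal C})$ be an $n$-vertex multigraph with a finite number of edges and (minimum) degree at least $\kappa\rho$. Let $G_{\mathcal C}'=(\mathcal C,E_{\mathcal C}')$ be the multigraph obtained from $G_{\mathcal C}$ by sampling each edge independently with probability $p=\min\{1,(12c+24)(1/(\rho^2\kappa))\ln n\}$. Then with probability $1-O(1/n^c)$, for every cut $(S,\mathcal C-S)$ in $\mathcal C$, 1. if $\Phi_{G_{\mathcal C}}(S)\ge\rho$ then $\Phi_{G_{\mathcal C}'}(S)$ deviates from $\Phi_{G_{\mathcal C}}(S)$ by a factor of at most $4$, and 2. if $\Phi_{G_{\mathcal C}}(S)<\rho$ then $\Phi_{G_{\mathcal C}'}(S)\le6\rho$.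
   Context: For a multigraph $G$ with vertex set $V_G$ and $S\subseteq V_G$: $\delta_G(S)$ is the number of edges (with multiplicity) with exactly one endpoint in $S$; $\mathrm{Vol}_G(S)$ is the number of edges (with multiplicity) incident to $S$; the conductance of the cut $(S,V_G-S)$, when both sides have positive volume, is $\Phi_G(S)=\delta_G(S)/\min\{\mathrm{Vol}_G(S),\mathrm{Vol}_G(V_G-S)\}$. Deviating by a factor of at most $4$ means $\frac14\Phi_{G_{\mathcal C}}(S)\le\Phi_{G_{\mathcal C}'}(S)\le4\Phi_{G_{\mathcal C}}(S)$. -}

module Defs where

open import Algebra.Bundles using (CommutativeRing)
open import Algebra.Structures using (IsCommutativeRing)
open import Data.Bool.Base using (true; false)
open import Data.Fin.Base using (Fin)
import Data.Fin.Properties as Fin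
open import Data.Fin.Subset using (Subset; _∈_; _∉_; Nonempty; ∁)
open import Data.Fin.Subset.Properties using (_∈?_; nonempty?; anySubset?)
open import Data.List.Base using (List; []; _∷_; _++_; map; filter; foldr; length; concatMap)
open import Data.Nat.Base as ℕ using (ℕ; zero; suc)
import Data.Nat.Properties as ℕ
open import Data.Product.Base using (_×_; _,_; ∃; ∃-syntax)
open import Data.Sum.Base using (_⊎_)
open import Data.Vec.Base using ([]; _∷_)
open import Level using (0ℓ)
open import Relation.Binary.Bundles using (DecTotalOrder)
open import Relation.Binary.Core using (Rel; _Preserves_⟶_)
open import Relation.Binary.Structures using (IsDecTotalOrder)
import Relation.Binary.Definitions as B
open import Relation.Nullary using (¬_; Dec)
open import Relation.Nullary.Decidable using (map′; ¬?; _×-dec_; _⊎-dec_; _→-dec_; decidable-stable)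
open import Relation.Unary using (Pred; Decidable)
import Algebra.Construct.NaturalChoice.Min as Min
import Algebra.Properties.Monoid.Mult as Mult
import Relation.Binary.Construct.NonStrictToStrict as Strict

private
  variable
    m n : ℕ
    A : Set

------------------------------------------------------------------------
-- Real numbers

-- The classical reals, presented axiomatically as a Dedekind-complete
-- ordered field with decidable order; completeness determines the field up
-- to isomorphism.  The structure includes the exponential and logarithm:
-- exp-+ and 1+x≤exp hold for no function ℝ → ℝ other than x ↦ eˣ, and
-- exp-ln then determines ln on the positive reals.

record RealNumbers : Set₁ where
  infix  9 _⁻¹
  infix  8 -_
  infixl 7 _*_
  infixl 6 _+_
  infix  4 _≈_ _≤_

  field
    ℝ     : Set
    _≈_   : Rel ℝ 0ℓ
    _≤_   : Rel ℝ 0ℓ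
    _+_   : ℝ → ℝ → ℝ
    _*_   : ℝ → ℝ → ℝ
    -_    : ℝ → ℝ
    0#    : ℝ
    1#    : ℝ
    _⁻¹   : ℝ → ℝ

    isCommutativeRing : IsCommutativeRing _≈_ _+_ _*_ -_ 0# 1#
    0≉1               : ¬ (0# ≈ 1#)
    -- 0# ⁻¹ is some unspecified element.
    ⁻¹-cong           : _⁻¹ Preserves _≈_ ⟶ _≈_
    ⁻¹-inverseʳ       : ∀ x → ¬ (x ≈ 0#) → x * x ⁻¹ ≈ 1#

    isDecTotalOrder   : IsDecTotalOrder _≈_ _≤_
    +-monoʳ-≤         : ∀ z {x y} → x ≤ y → z + x ≤ z + y
    *-nonNeg          : ∀ {x y} → 0# ≤ x → 0# ≤ y → 0# ≤ x * y

  IsUpperBound : Pred ℝ 0ℓ → Pred ℝ 0ℓ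
  IsUpperBound P u = ∀ {x} → P x → x ≤ u

  field
    supremum : (P : Pred ℝ 0ℓ) → ∃ P → ∃ (IsUpperBound P) →
               ∃[ s ] IsUpperBound P s × (∀ {u} → IsUpperBound P u → s ≤ u)

  commutativeRing : CommutativeRing 0ℓ 0ℓ
  commutativeRing = record { isCommutativeRing = isCommutativeRing }

  decTotalOrder : DecTotalOrder 0ℓ 0ℓ 0ℓ
  decTotalOrder = record { isDecTotalOrder = isDecTotalOrder }

  open DecTotalOrder decTotalOrder public using (_≟_; _≤?_; totalOrder)
  open Strict _≈_ _≤_ public using (_<_)

  field
    exp      : ℝ → ℝ
    exp-cong : exp Preserves _≈_ ⟶ _≈_
    exp-+    : ∀ x y → exp (x + y) ≈ exp x * exp y
    1+x≤exp  : ∀ x → 1# + x ≤ exp x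

    ln       : ℝ → ℝ
    ln-cong  : ln Preserves _≈_ ⟶ _≈_
    exp-ln   : ∀ x → 0# < x → exp (ln x) ≈ x

  _<?_ : B.Decidable _<_
  _<?_ = Strict.<-decidable _≈_ _≤_ _≟_ _≤?_

  open Min totalOrder public using (_⊓_)

  infixl 6 _-_
  _-_ : ℝ → ℝ → ℝ
  x - y = x + - y

  infixl 7 _/_
  _/_ : ℝ → ℝ → ℝ
  x / y = x * y ⁻¹

  fromℕ : ℕ → ℝ
  fromℕ k = k · 1#
    where open Mult (CommutativeRing.+-monoid commutativeRing) renaming (_×_ to _·_)

  -- Real powers of a positive base.
  infixr 8 _^_
  _^_ : ℝ → ℝ → ℝ
  x ^ y = exp (y * ln x)

------------------------------------------------------------------------
-- Multigraphs

-- A pair (u , v) stands for an unordered edge {u , v}; every notion below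
-- is symmetric in its two components.  Loops are permitted.

record Multigraph (n : ℕ) : Set where
  constructor multigraph
  field
    edges : List (Fin n × Fin n)

open Multigraph public

∣E∣ : Multigraph n → ℕ
∣E∣ G = length (edges G)

-- A loop at v contributes 2.
degree : Multigraph n → Fin n → ℕ
degree G v = length (filter (v Fin.≟_) (concatMap (λ (a , b) → a ∷ b ∷ []) (edges G)))

Crosses : Subset n → Pred (Fin n × Fin n) 0ℓ
Crosses S (a , b) = (a ∈ S × b ∉ S) ⊎ (a ∉ S × b ∈ S)

Incident : Subset n → Pred (Fin n × Fin n) 0ℓ
Incident S (a , b) = a ∈ S ⊎ b ∈ S

crosses? : (S : Subset n) → Decidable (Crosses S)
crosses? S (a , b) = ((a ∈? S) ×-dec ¬? (b ∈? S)) ⊎-dec (¬? (a ∈? S) ×-dec (b ∈? S))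

incident? : (S : Subset n) → Decidable (Incident S)
incident? S (a , b) = (a ∈? S) ⊎-dec (b ∈? S)

δ : Multigraph n → Subset n → ℕ
δ G S = length (filter (crosses? S) (edges G))

Vol : Multigraph n → Subset n → ℕ
Vol G S = length (filter (incident? S) (edges G))

-- S and its complement form a cut.
IsCut : Pred (Subset n) 0ℓ
IsCut S = Nonempty S × Nonempty (∁ S)

-- Both sides have positive volume, so the conductance is defined.
HasConductance : Multigraph n → Pred (Subset n) 0ℓ
HasConductance G S = 0 ℕ.< Vol G S × 0 ℕ.< Vol G (∁ S)

select : (xs : List A) → Subset (length xs) → List A
select []       []          = []
select (x ∷ xs) (true  ∷ ω) = x ∷ select xs ω
select (x ∷ xs) (false ∷ ω) = select xs ω

sampled : (G : Multigraph n) → Subset (∣E∣ G) → Multigraph n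
sampled G ω = multigraph (select (edges G) ω)

------------------------------------------------------------------------
-- Finite enumeration

subsets : ∀ m → List (Subset m)
subsets zero    = [] ∷ []
subsets (suc m) = map (true ∷_) (subsets m) ++ map (false ∷_) (subsets m)

allSubset? : {P : Pred (Subset n) 0ℓ} → Decidable P → Dec (∀ S → P S)
allSubset? P? = map′ (λ ¬∃¬P S → decidable-stable (P? S) (λ ¬PS → ¬∃¬P (S , ¬PS)))
                     (λ ∀P (S , ¬PS) → ¬PS (∀P S))
                     (¬? (anySubset? (λ S → ¬? (P? S))))

module Sampling (R : RealNumbers) where
  open RealNumbers R

  ----------------------------------------------------------------------
  -- Independent sampling: the product of m Bernoulli(p) measures

  weight : ℝ → Subset m → ℝ
  weight p []          = 1#
  weight p (true  ∷ ω) = p * weight p ω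
  weight p (false ∷ ω) = (1# - p) * weight p ω

  Pr : ℝ → {E : Pred (Subset m) 0ℓ} → Decidable E → ℝ
  Pr {m} p E? = foldr _+_ 0# (map (weight p) (filter E? (subsets m)))

  ----------------------------------------------------------------------
  -- Conductance

  -- Meaningful only when HasConductance G S.
  Φ : Multigraph n → Subset n → ℝ
  Φ G S = fromℕ (δ G S) / fromℕ (Vol G S ℕ.⊓ Vol G (∁ S))

  -- y deviates from x by a factor of at most k.
  DeviatesAtMost : ℝ → ℝ → ℝ → Set
  DeviatesAtMost k x y = k ⁻¹ * x ≤ y × y ≤ k * x

  -- A conclusion about the conductance in G′ includes its being defined.
  ConductancePreserved : ℝ → Multigraph n → Multigraph n → Pred (Subset n) 0ℓ
  ConductancePreserved ρ G G′ S =
    (ρ ≤ Φ G S → HasConductance G′ S × DeviatesAtMost (fromℕ 4) (Φ G S) (Φ G′ S)) ×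
    (Φ G S < ρ → HasConductance G′ S × Φ G′ S ≤ fromℕ 6 * ρ)

  AllCutsPreserved : ℝ → (G : Multigraph n) → Pred (Subset (∣E∣ G)) 0ℓ
  AllCutsPreserved ρ G ω = ∀ S → IsCut S → ConductancePreserved ρ G (sampled G ω) S

  hasConductance? : (G : Multigraph n) → Decidable (HasConductance G)
  hasConductance? G S = (0 ℕ.<? Vol G S) ×-dec (0 ℕ.<? Vol G (∁ S))

  conductancePreserved? : ∀ ρ (G G′ : Multigraph n) → Decidable (ConductancePreserved ρ G G′)
  conductancePreserved? ρ G G′ S =
    ((ρ ≤? Φ G S) →-dec
      (hasConductance? G′ S ×-dec
        ((fromℕ 4 ⁻¹ * Φ G S ≤? Φ G′ S) ×-dec (Φ G′ S ≤? fromℕ 4 * Φ G S)))) ×-dec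
    ((Φ G S <? ρ) →-dec
      (hasConductance? G′ S ×-dec (Φ G′ S ≤? fromℕ 6 * ρ)))

  allCutsPreserved? : ∀ ρ (G : Multigraph n) → Decidable (AllCutsPreserved ρ G)
  allCutsPreserved? ρ G ω = allSubset? λ S →
    (nonempty? S ×-dec nonempty? (∁ S)) →-dec
      conductancePreserved? ρ G (sampled G ω) S

  samplingProbability : (c κ ρ : ℝ) (n : ℕ) → ℝ
  samplingProbability c κ ρ n =
    1# ⊓ ((fromℕ 12 * c + fromℕ 24) * (1# / (ρ * ρ * κ)) * ln (fromℕ n))

{-# OPTIONS --safe #-}
-- For a random sum X of independent indicators with mean D, Chernoff's method gives
-- Pr (X ≤ 7/16 D) ≤ e^(−D/6) and Pr (X ≥ 7/4 D) ≤ e^(−D/6).  A vertex set T has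
-- Vol T ≥ |T|κρ/2, so if p < 1, a sampled count with D ≥ pρ Vol T leaves this window
-- with probability at most 2 e^(−pρ Vol T / 6) ≤ 2 n^(−(c+2)|T|).  A union bound over
-- the nonempty T costs (1 + n^(−(c+2)))ⁿ − 1 ≤ 2 n^(−c) for each of the four tails (lower and
-- upper, for Vol and δ).  Since (7/4) / (7/16) = 4, confining numerator and denominator of Φ
-- to the window keeps Φ within a factor of 4.  If p = 1, the sample is almost surely G itself.
module Submission where

open import Algebra.Bundles using (CommutativeRing)
open import Data.Bool.Base using (Bool; true; false; _∨_)
open import Data.Fin.Base using (Fin; zero; suc)
import Data.Fin.Properties as Fin
open import Data.Fin.Subset using (Subset; ⊤; ∣_∣; Nonempty; ∁)
open import Data.Fin.Subset.Properties using (_∈?_; x∈∁p⇒x∉p; x∉p⇒x∈∁p; x∉∁p⇒x∈p; x∈p⇒x∉∁p; x∈p⇒∣p-x∣<∣p∣)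
open import Data.Integer.Base as ℤ using (ℤ; +_; -[1+_]; _⊖_)
import Data.Integer.Properties as ℤ
open import Data.List.Base using (List; []; _∷_; _++_; map; filter; foldr; length)
open import Data.List.Membership.Propositional using (_∈_)
open import Data.List.Membership.Propositional.Properties using (∈-map⁺; ∈-++⁺ˡ; ∈-++⁺ʳ; ∈-filter⁺)
open import Data.List.Properties using (filter-≐)
open import Data.List.Relation.Unary.Any using (here; there)
open import Data.Maybe.Base using (Maybe; just; nothing)
open import Data.Nat.Base as ℕ using (ℕ; zero; suc; NonZero)
import Data.Nat.Properties as ℕ
import Data.Nat.Solver as ℕ-Solver
open import Data.Product.Base as Product using (_×_; _,_; ∃; proj₁; proj₂)
open import Data.Sum.Base as Sum using (_⊎_; inj₁; inj₂)
open import Data.Unit.Base using (tt)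
open import Data.Vec.Base using ([]; _∷_; here; there)
open import Function.Base using (_∘_)
open import Level using (0ℓ)
open import Relation.Binary.Bundles using (DecTotalOrder)
open import Relation.Binary.PropositionalEquality.Core as ≡ using (_≡_)
open import Relation.Nullary using (¬_; does; yes; no; contradiction)
open import Relation.Unary using (Pred; Decidable)
import Algebra.Construct.NaturalChoice.Max as Max
import Algebra.Construct.NaturalChoice.Min as Min
import Algebra.Properties.Ring as RingProperties
import Algebra.Properties.Semiring.Mult as SemiringMult
import Algebra.Solver.Ring as RingSolver
import Algebra.Solver.Ring.AlmostCommutativeRing as ACR
import Relation.Binary.Reasoning.PartialOrder as PartialOrderReasoning
import Relation.Binary.Reasoning.Setoid as SetoidReasoning
open import Defs

-- A sparse cut may have an expected sampled size far too small for concentration. So all four tails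
-- of a set `T` are measured on one scale, `p * (ρ * Vol G T)`. The mean of the sampled volume
-- reaches it because ρ ≤ 1, and the mean of the sampled cut reaches it when δ ≥ ρ Vol. Otherwise
-- only an upper bound on the cut relative to ρ Vol is wanted. This accounts for ρ² in the sampling
-- probability: one factor pays for this scale, the other for the degree bound κρ.
--
-- Failure is never treated as an event with a probability of its own. It is dominated by
-- exponentials that reach 1 when a window is violated; these are summed over all `T`, and the
-- expectation of the sum is compared with `Pr` once. Markov's inequality and the union bound
-- thereby reduce to linearity of `𝔼`.

private
  variable
    m n : ℕ
    A : Set

-- Ring identities with integer coefficients

module IntegerSolver {c ℓ} (R : CommutativeRing c ℓ) where
  open CommutativeRing R
  open RingProperties ring
  open SemiringMult semiring using (×-homo-+; ×1-homo-*) renaming (_×_ to _·_)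
  open SetoidReasoning setoid

  private
    ι : ℤ → Carrier
    ι (+ n)    = n · 1#
    ι -[1+ n ] = - (suc n · 1#)

    ι-⊖ : ∀ m n → ι (m ⊖ n) ≈ m · 1# - n · 1#
    ι-⊖ m zero = begin
      m · 1#       ≈⟨ +-identityʳ _ ⟨
      m · 1# + 0#  ≈⟨ +-congˡ -0#≈0# ⟨
      m · 1# - 0#  ∎
    ι-⊖ zero (suc n) = sym (+-identityˡ _)
    ι-⊖ (suc m) (suc n) = begin
      ι (suc m ⊖ suc n)                  ≡⟨ ≡.cong ι (ℤ.[1+m]⊖[1+n]≡m⊖n m n) ⟩
      ι (m ⊖ n)                          ≈⟨ ι-⊖ m n ⟩
      m · 1# - n · 1#                    ≈⟨ +-congʳ (+-identityˡ _) ⟨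
      (0# + m · 1#) - n · 1#             ≈⟨ +-congʳ (+-congʳ (-‿inverseʳ 1#)) ⟨
      (1# - 1# + m · 1#) - n · 1#        ≈⟨ +-congʳ (+-assoc _ _ _) ⟩
      (1# + (- 1# + m · 1#)) - n · 1#    ≈⟨ +-congʳ (+-congˡ (+-comm _ _)) ⟩
      (1# + (m · 1# - 1#)) - n · 1#      ≈⟨ +-congʳ (+-assoc _ _ _) ⟨
      ((1# + m · 1#) - 1#) - n · 1#      ≈⟨ +-assoc _ _ _ ⟩
      (1# + m · 1#) + (- 1# - n · 1#)    ≈⟨ +-congˡ (-‿+-comm _ _) ⟩
      (1# + m · 1#) - (1# + n · 1#)      ∎

    ι-+ : ∀ i j → ι (i ℤ.+ j) ≈ ι i + ι j
    ι-+ (+ m)    (+ n)    = ×-homo-+ 1# m n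
    ι-+ (+ m)    -[1+ n ] = ι-⊖ m (suc n)
    ι-+ -[1+ m ] (+ n)    = trans (ι-⊖ n (suc m)) (+-comm _ _)
    ι-+ -[1+ m ] -[1+ n ] = begin
      - (suc (suc (m ℕ.+ n)) · 1#)          ≡⟨ ≡.cong (λ k → - (suc k · 1#)) (ℕ.+-suc m n) ⟨
      - ((suc m ℕ.+ suc n) · 1#)            ≈⟨ -‿cong (×-homo-+ 1# (suc m) (suc n)) ⟩
      - (suc m · 1# + suc n · 1#)           ≈⟨ -‿+-comm _ _ ⟨
      - (suc m · 1#) - (suc n · 1#)         ∎

    ι-neg : ∀ i → ι (ℤ.- i) ≈ - ι i
    ι-neg (+ zero)  = sym -0#≈0#
    ι-neg (+ suc n) = refl
    ι-neg -[1+ n ]  = sym (-‿involutive _)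

    ι-* : ∀ i j → ι (i ℤ.* j) ≈ ι i * ι j
    ι-*⁺ : ∀ m j → ι (+ m ℤ.* j) ≈ ι (+ m) * ι j
    ι-*⁺ m (+ n) = trans (reflexive (≡.cong ι (≡.sym (ℤ.pos-* m n)))) (×1-homo-* m n)
    ι-*⁺ m -[1+ n ] = begin
      ι (+ m ℤ.* -[1+ n ])        ≡⟨ ≡.cong ι (ℤ.neg-distribʳ-* (+ m) (+ suc n)) ⟨
      ι (ℤ.- (+ m ℤ.* + suc n))   ≈⟨ ι-neg (+ m ℤ.* + suc n) ⟩
      - ι (+ m ℤ.* + suc n)       ≈⟨ -‿cong (ι-*⁺ m (+ suc n)) ⟩
      - (ι (+ m) * ι (+ suc n))   ≈⟨ -‿distribʳ-* _ _ ⟩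
      ι (+ m) * - ι (+ suc n)     ∎
    ι-* (+ m) j = ι-*⁺ m j
    ι-* -[1+ m ] j = begin
      ι (-[1+ m ] ℤ.* j)          ≡⟨ ≡.cong ι (ℤ.neg-distribˡ-* (+ suc m) j) ⟨
      ι (ℤ.- (+ suc m ℤ.* j))     ≈⟨ ι-neg (+ suc m ℤ.* j) ⟩
      - ι (+ suc m ℤ.* j)         ≈⟨ -‿cong (ι-*⁺ (suc m) j) ⟩
      - (ι (+ suc m) * ι j)       ≈⟨ -‿distribˡ-* _ _ ⟩
      - ι (+ suc m) * ι j         ∎

    -- ι with ι (+ 1) reduced to 1#, so that con (+ 1) denotes the literal 1#.
    ⟦_⟧ : ℤ → Carrier
    ⟦ + 1 ⟧ = 1#
    ⟦ i ⟧   = ι i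

    ⟦⟧≈ι : ∀ i → ⟦ i ⟧ ≈ ι i
    ⟦⟧≈ι (+ 0)           = refl
    ⟦⟧≈ι (+ 1)           = sym (+-identityʳ 1#)
    ⟦⟧≈ι (+ suc (suc _)) = refl
    ⟦⟧≈ι -[1+ _ ]        = refl

    morphism : ℤ.+-*-rawRing ACR.-Raw-AlmostCommutative⟶ ACR.fromCommutativeRing R
    morphism = record
      { ⟦_⟧    = ⟦_⟧
      ; +-homo = λ i j → trans (⟦⟧≈ι (i ℤ.+ j)) (trans (ι-+ i j) (sym (+-cong (⟦⟧≈ι i) (⟦⟧≈ι j))))
      ; *-homo = λ i j → trans (⟦⟧≈ι (i ℤ.* j)) (trans (ι-* i j) (sym (*-cong (⟦⟧≈ι i) (⟦⟧≈ι j))))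
      ; -‿homo = λ i → trans (⟦⟧≈ι (ℤ.- i)) (trans (ι-neg i) (sym (-‿cong (⟦⟧≈ι i))))
      ; 0-homo = refl
      ; 1-homo = refl
      }

    -- Coefficients are compared in ℤ, where equality computes; in an abstract ring it does not.
    coeff≟ : ∀ i j → Maybe (⟦ i ⟧ ≈ ⟦ j ⟧)
    coeff≟ i j with i ℤ.≟ j
    ... | yes ≡.refl = just refl
    ... | no _       = nothing

  -- For k ≥ 2, `con (+ k)` evaluates to `k · 1#`, which over the reals is `fromℕ k` by definition,
  -- so numerals need no conversion.
  open RingSolver ℤ.+-*-rawRing (ACR.fromCommutativeRing R) morphism coeff≟ public
    using (solve; _:=_; _:+_; _:*_; _:-_; :-_; con)

-- Ordered-field arithmetic, exponential and logarithm

module OrderedField (R : RealNumbers) where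
  open RealNumbers R
  open CommutativeRing commutativeRing public
    using (refl; sym; trans; +-cong; +-congˡ; +-congʳ; *-cong; *-congˡ; *-congʳ; -‿cong;
           +-identityˡ; +-identityʳ; *-identityˡ; *-identityʳ; *-comm; zeroˡ; zeroʳ; semiring)
  open DecTotalOrder decTotalOrder public
    using (poset) renaming (refl to ≤-refl; reflexive to ≤-reflexive; trans to ≤-trans; antisym to ≤-antisym; total to ≤-total)
  open SemiringMult semiring using (×-homo-+; ×1-homo-*)
  open IntegerSolver commutativeRing public
  module ≤-Reasoning = PartialOrderReasoning poset
  open ≤-Reasoning

  -- The standard form of an inequality proof below: `d` is a certificate of nonnegativity, and what
  -- remains is a ring identity for the solver.
  ≤-by : ∀ {x y} d → 0# ≤ d → y ≈ x + d → x ≤ y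
  ≤-by {x} {y} d 0≤d y≈x+d = begin
    x       ≈⟨ +-identityʳ x ⟨
    x + 0#  ≤⟨ +-monoʳ-≤ x 0≤d ⟩
    x + d   ≈⟨ y≈x+d ⟨
    y       ∎

  x≤y⇒0≤y-x : ∀ {x y} → x ≤ y → 0# ≤ y - x
  x≤y⇒0≤y-x {x} {y} x≤y = begin
    0#       ≈⟨ solve 1 (λ x → con (+ 0) := :- x :+ x) refl x ⟩
    - x + x  ≤⟨ +-monoʳ-≤ (- x) x≤y ⟩
    - x + y  ≈⟨ solve 2 (λ x y → :- x :+ y := y :- x) refl x y ⟩
    y - x    ∎

  +-mono-≤ : ∀ {x y u v} → x ≤ y → u ≤ v → x + u ≤ y + v
  +-mono-≤ {x} {y} {u} {v} x≤y u≤v = begin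
    x + u  ≤⟨ +-monoʳ-≤ x u≤v ⟩
    x + v  ≈⟨ solve 2 (λ x v → x :+ v := v :+ x) refl x v ⟩
    v + x  ≤⟨ +-monoʳ-≤ v x≤y ⟩
    v + y  ≈⟨ solve 2 (λ x v → x :+ v := v :+ x) refl v y ⟩
    y + v  ∎

  +-nonNeg : ∀ {x y} → 0# ≤ x → 0# ≤ y → 0# ≤ x + y
  +-nonNeg 0≤x 0≤y = ≤-trans (≤-reflexive (sym (+-identityˡ 0#))) (+-mono-≤ 0≤x 0≤y)

  *-monoˡ-≤ : ∀ {x y z} → 0# ≤ z → x ≤ y → z * x ≤ z * y
  *-monoˡ-≤ {x} {y} {z} 0≤z x≤y = ≤-by (z * (y - x)) (*-nonNeg 0≤z (x≤y⇒0≤y-x x≤y))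
    (solve 3 (λ x y z → z :* y := z :* x :+ z :* (y :- x)) refl x y z)

  *-mono-≤ : ∀ {x y u v} → 0# ≤ x → 0# ≤ v → x ≤ y → u ≤ v → x * u ≤ y * v
  *-mono-≤ {x} {y} {u} {v} 0≤x 0≤v x≤y u≤v = begin
    x * u  ≤⟨ *-monoˡ-≤ 0≤x u≤v ⟩
    x * v  ≈⟨ *-comm x v ⟩
    v * x  ≤⟨ *-monoˡ-≤ 0≤v x≤y ⟩
    v * y  ≈⟨ *-comm v y ⟩
    y * v  ∎

  square-nonNeg : ∀ x → 0# ≤ x * x
  square-nonNeg x with ≤-total 0# x
  ... | inj₁ 0≤x = *-nonNeg 0≤x 0≤x
  ... | inj₂ x≤0 = begin
    0#                     ≤⟨ *-nonNeg (x≤y⇒0≤y-x x≤0) (x≤y⇒0≤y-x x≤0) ⟩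
    (0# - x) * (0# - x)    ≈⟨ solve 1 (λ x → (con (+ 0) :- x) :* (con (+ 0) :- x) := x :* x) refl x ⟩
    x * x                  ∎

  0≤1 : 0# ≤ 1#
  0≤1 = ≤-trans (square-nonNeg 1#) (≤-reflexive (*-identityˡ 1#))

  0<1 : 0# < 1#
  0<1 = 0≤1 , 0≉1

  <-≤-trans : ∀ {x y z} → x < y → y ≤ z → x < z
  <-≤-trans {x} {y} {z} x<y y≤z = begin-strict
    x  <⟨ x<y ⟩
    y  ≤⟨ y≤z ⟩
    z  ∎

  ≤⇒≯ : ∀ {x y} → x ≤ y → ¬ (y < x)
  ≤⇒≯ x≤y (y≤x , y≉x) = y≉x (≤-antisym y≤x x≤y)

  ≰⇒> : ∀ {x y} → ¬ (x ≤ y) → y < x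
  ≰⇒> {x} {y} x≰y with ≤-total x y
  ... | inj₁ x≤y = contradiction x≤y x≰y
  ... | inj₂ y≤x = y≤x , λ y≈x → x≰y (≤-reflexive (sym y≈x))

  ≮⇒≥ : ∀ {x y} → ¬ (x < y) → y ≤ x
  ≮⇒≥ {x} {y} x≮y with y ≤? x
  ... | yes y≤x = y≤x
  ... | no y≰x = contradiction (≰⇒> y≰x) x≮y

  >⇒≉ : ∀ {x} → 0# < x → ¬ (x ≈ 0#)
  >⇒≉ (_ , 0≉x) x≈0 = 0≉x (sym x≈0)

  *-inverse : ∀ {x} → 0# < x → x * x ⁻¹ ≈ 1#
  *-inverse {x} 0<x = ⁻¹-inverseʳ x (>⇒≉ 0<x)

  -- A positive x has x⁻¹ = x (x⁻¹)².
  ⁻¹-nonNeg : ∀ {x} → 0# < x → 0# ≤ x ⁻¹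
  ⁻¹-nonNeg {x} 0<x = begin
    0#                      ≤⟨ *-nonNeg (proj₁ 0<x) (square-nonNeg (x ⁻¹)) ⟩
    x * (x ⁻¹ * x ⁻¹)       ≈⟨ solve 2 (λ x y → x :* (y :* y) := (x :* y) :* y) refl x (x ⁻¹) ⟩
    (x * x ⁻¹) * x ⁻¹       ≈⟨ *-congʳ (*-inverse 0<x) ⟩
    1# * x ⁻¹               ≈⟨ *-identityˡ (x ⁻¹) ⟩
    x ⁻¹                    ∎

  *-inverse-assoc : ∀ {z} → 0# < z → ∀ x → z ⁻¹ * (z * x) ≈ x
  *-inverse-assoc {z} 0<z x = trans
    (solve 3 (λ z i x → i :* (z :* x) := (z :* i) :* x) refl z (z ⁻¹) x)
    (trans (*-congʳ (*-inverse 0<z)) (*-identityˡ x))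

  *-cancelˡ-≤ : ∀ {x y z} → 0# < z → z * x ≤ z * y → x ≤ y
  *-cancelˡ-≤ {x} {y} {z} 0<z zx≤zy = begin
    x               ≈⟨ *-inverse-assoc 0<z x ⟨
    z ⁻¹ * (z * x)  ≤⟨ *-monoˡ-≤ (⁻¹-nonNeg 0<z) zx≤zy ⟩
    z ⁻¹ * (z * y)  ≈⟨ *-inverse-assoc 0<z y ⟩
    y               ∎

  *-pos : ∀ {x y} → 0# < x → 0# < y → 0# < x * y
  *-pos {x} {y} 0<x 0<y = *-nonNeg (proj₁ 0<x) (proj₁ 0<y) , λ 0≈xy → proj₂ 0<y (begin-equality
    0#              ≈⟨ zeroʳ (x ⁻¹) ⟨
    x ⁻¹ * 0#       ≈⟨ *-congˡ 0≈xy ⟩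
    x ⁻¹ * (x * y)  ≈⟨ *-inverse-assoc 0<x y ⟩
    y               ∎)

  ≤-*⇒/-≤ : ∀ {x y z} → 0# < y → x ≤ z * y → x / y ≤ z
  ≤-*⇒/-≤ {x} {y} {z} 0<y x≤zy = begin
    x * y ⁻¹        ≈⟨ *-comm _ _ ⟩
    y ⁻¹ * x        ≤⟨ *-monoˡ-≤ (⁻¹-nonNeg 0<y) x≤zy ⟩
    y ⁻¹ * (z * y)  ≈⟨ *-congˡ (*-comm z y) ⟩
    y ⁻¹ * (y * z)  ≈⟨ *-inverse-assoc 0<y z ⟩
    z               ∎

  *-≤⇒≤-/ : ∀ {x y z} → 0# < y → z * y ≤ x → z ≤ x / y
  *-≤⇒≤-/ {x} {y} {z} 0<y zy≤x = begin
    z               ≈⟨ *-inverse-assoc 0<y z ⟨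
    y ⁻¹ * (y * z)  ≈⟨ *-congˡ (*-comm z y) ⟨
    y ⁻¹ * (z * y)  ≤⟨ *-monoˡ-≤ (⁻¹-nonNeg 0<y) zy≤x ⟩
    y ⁻¹ * x        ≈⟨ *-comm _ _ ⟩
    x * y ⁻¹        ∎

  /-* : ∀ {x y} → 0# < y → x / y * y ≈ x
  /-* {x} {y} 0<y = trans
    (solve 3 (λ x y i → x :* i :* y := i :* (y :* x)) refl x y (y ⁻¹))
    (*-inverse-assoc 0<y x)

  fromℕ-+ : ∀ m n → fromℕ (m ℕ.+ n) ≈ fromℕ m + fromℕ n
  fromℕ-+ = ×-homo-+ 1#

  fromℕ-* : ∀ m n → fromℕ (m ℕ.* n) ≈ fromℕ m * fromℕ n
  fromℕ-* = ×1-homo-*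

  fromℕ-nonNeg : ∀ n → 0# ≤ fromℕ n
  fromℕ-nonNeg zero    = ≤-refl
  fromℕ-nonNeg (suc n) = +-nonNeg 0≤1 (fromℕ-nonNeg n)

  fromℕ-mono : ∀ {m n} → m ℕ.≤ n → fromℕ m ≤ fromℕ n
  fromℕ-mono {n = n} ℕ.z≤n = fromℕ-nonNeg n
  fromℕ-mono (ℕ.s≤s m≤n)   = +-monoʳ-≤ 1# (fromℕ-mono m≤n)

  1≤fromℕ : ∀ {n} → 0 ℕ.< n → 1# ≤ fromℕ n
  1≤fromℕ 0<n = ≤-trans (≤-reflexive (sym (+-identityʳ 1#))) (fromℕ-mono 0<n)

  fromℕ-pos : ∀ {n} → 0 ℕ.< n → 0# < fromℕ n
  fromℕ-pos 0<n = <-≤-trans 0<1 (1≤fromℕ 0<n)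

  fromℕ-pos⁻¹ : ∀ {n} → 0# < fromℕ n → 0 ℕ.< n
  fromℕ-pos⁻¹ {zero}  0<0 = contradiction refl (proj₂ 0<0)
  fromℕ-pos⁻¹ {suc n} _   = ℕ.z<s

  -- For x ≤ 0, `exp x` is the product of `exp (- x)`, which is at least 1, and the square of
  -- `exp x`.
  exp-nonNeg : ∀ x → 0# ≤ exp x

  -- `exp 0#` equals its own square, and `1+x≤exp` makes it positive, so one factor cancels.
  exp-0 : exp 0# ≈ 1#
  exp-0 = begin-equality
    exp 0#                          ≈⟨ *-inverse-assoc 0<e (exp 0#) ⟨
    exp 0# ⁻¹ * (exp 0# * exp 0#)   ≈⟨ *-congˡ (exp-+ 0# 0#) ⟨
    exp 0# ⁻¹ * exp (0# + 0#)       ≈⟨ *-congˡ (exp-cong (+-identityˡ 0#)) ⟩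
    exp 0# ⁻¹ * exp 0#              ≈⟨ *-comm _ _ ⟩
    exp 0# * exp 0# ⁻¹              ≈⟨ *-inverse 0<e ⟩
    1#                              ∎
    where
    0<e : 0# < exp 0#
    0<e = <-≤-trans 0<1 (≤-trans (≤-reflexive (sym (+-identityʳ 1#))) (1+x≤exp 0#))

  exp-inverse : ∀ x → exp x * exp (- x) ≈ 1#
  exp-inverse x = begin-equality
    exp x * exp (- x)  ≈⟨ exp-+ x (- x) ⟨
    exp (x - x)        ≈⟨ exp-cong (solve 1 (λ x → x :- x := con (+ 0)) refl x) ⟩
    exp 0#             ≈⟨ exp-0 ⟩
    1#                 ∎

  1≤exp : ∀ {x} → 0# ≤ x → 1# ≤ exp x
  1≤exp {x} 0≤x = ≤-trans (≤-by x 0≤x refl) (1+x≤exp x)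

  exp-nonNeg x with ≤-total 0# x
  ... | inj₁ 0≤x = ≤-trans 0≤1 (1≤exp 0≤x)
  ... | inj₂ x≤0 = begin
    0#                               ≤⟨ *-nonNeg (≤-trans 0≤1 (1≤exp 0≤-x)) (square-nonNeg (exp x)) ⟩
    exp (- x) * (exp x * exp x)      ≈⟨ solve 2 (λ e f → f :* (e :* e) := (e :* f) :* e) refl (exp x) (exp (- x)) ⟩
    (exp x * exp (- x)) * exp x      ≈⟨ *-congʳ (exp-inverse x) ⟩
    1# * exp x                       ≈⟨ *-identityˡ _ ⟩
    exp x                            ∎
    where
    0≤-x : 0# ≤ - x
    0≤-x = ≤-trans (x≤y⇒0≤y-x x≤0) (≤-reflexive (+-identityˡ (- x)))

  exp-mono : ∀ {x y} → x ≤ y → exp x ≤ exp y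
  exp-mono {x} {y} x≤y = begin
    exp x                ≈⟨ *-identityʳ _ ⟨
    exp x * 1#           ≤⟨ *-monoˡ-≤ (exp-nonNeg x) (1≤exp (x≤y⇒0≤y-x x≤y)) ⟩
    exp x * exp (y - x)  ≈⟨ exp-+ x (y - x) ⟨
    exp (x + (y - x))    ≈⟨ exp-cong (solve 2 (λ x y → x :+ (y :- x) := y) refl x y) ⟩
    exp y                ∎

  exp<1⇒<0 : ∀ {x} → exp x < 1# → x < 0#
  exp<1⇒<0 ex<1 = ≰⇒> λ 0≤x → ≤⇒≯ (1≤exp 0≤x) ex<1

  exp-pos : ∀ x → 0# < exp x
  exp-pos x = exp-nonNeg x , λ 0≈e → 0≉1 (begin-equality
    0#                 ≈⟨ zeroˡ _ ⟨
    0# * exp (- x)     ≈⟨ *-congʳ 0≈e ⟩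
    exp x * exp (- x)  ≈⟨ exp-inverse x ⟩
    1#                 ∎)

  1/exp : ∀ x → 1# / exp x ≈ exp (- x)
  1/exp x = begin-equality
    1# * exp x ⁻¹                     ≈⟨ *-comm _ _ ⟩
    exp x ⁻¹ * 1#                     ≈⟨ *-congˡ (exp-inverse x) ⟨
    exp x ⁻¹ * (exp x * exp (- x))    ≈⟨ *-inverse-assoc (exp-pos x) _ ⟩
    exp (- x)                         ∎

  -- The bound 1 + z ≤ e^z at z = -ln x gives 1 - ln x ≤ 1/x ≤ 1.
  ln-nonNeg : ∀ {x} → 1# ≤ x → 0# ≤ ln x
  ln-nonNeg {x} 1≤x = ≤-by _ (+-nonNeg (x≤y⇒0≤y-x exp-≤1) (x≤y⇒0≤y-x 1≤exp-))
    (solve 2 (λ l e → l := con (+ 0) :+ ((con (+ 1) :- e) :+ (e :- (con (+ 1) :- l)))) refl (ln x) (exp (- ln x)))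
    where
    ex≈x : exp (ln x) ≈ x
    ex≈x = exp-ln x (<-≤-trans 0<1 1≤x)
    exp-≤1 : exp (- ln x) ≤ 1#
    exp-≤1 = begin
      exp (- ln x)               ≈⟨ *-identityˡ _ ⟨
      1# * exp (- ln x)          ≤⟨ *-mono-≤ 0≤1 (exp-nonNeg _) 1≤x ≤-refl ⟩
      x * exp (- ln x)           ≈⟨ *-congʳ ex≈x ⟨
      exp (ln x) * exp (- ln x)  ≈⟨ exp-inverse _ ⟩
      1#                         ∎
    1≤exp- : 1# - ln x ≤ exp (- ln x)
    1≤exp- = 1+x≤exp (- ln x)

-- Enumeration of vertex sets

subsets-complete : (S : Subset n) → S ∈ subsets n
subsets-complete []                  = here ≡.refl
subsets-complete {suc n} (true  ∷ S) = ∈-++⁺ˡ (∈-map⁺ _ (subsets-complete S))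
subsets-complete {suc n} (false ∷ S) = ∈-++⁺ʳ (map (true ∷_) (subsets n)) (∈-map⁺ _ (subsets-complete S))

-- Defined by recursion and not as a filter of `subsets`, because (1 + x)^n - 1 is later bounded by
-- induction along this split.
nonemptySubsets : ∀ n → List (Subset n)
nonemptySubsets zero    = []
nonemptySubsets (suc n) = map (true ∷_) (subsets n) ++ map (false ∷_) (nonemptySubsets n)

nonemptySubsets-complete : {S : Subset n} → Nonempty S → S ∈ nonemptySubsets n
nonemptySubsets-complete {S = true ∷ S}          _               = ∈-++⁺ˡ (∈-map⁺ _ (subsets-complete S))
nonemptySubsets-complete {suc n} {S = false ∷ S} (_ , there v∈S) =
  ∈-++⁺ʳ (map (true ∷_) (subsets n)) (∈-map⁺ _ (nonemptySubsets-complete (_ , v∈S)))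

count : {P : Pred A 0ℓ} → Decidable P → List A → ℕ
count P? xs = length (filter P? xs)

-- Expectations and exponential moments

module Probability (R : RealNumbers) where
  open RealNumbers R
  open OrderedField R
  open Sampling R using (weight; Pr)
  open ≤-Reasoning

  ∑ : List A → (A → ℝ) → ℝ
  ∑ xs f = foldr _+_ 0# (map f xs)

  ∑-mono : ∀ (xs : List A) {f g} → (∀ x → f x ≤ g x) → ∑ xs f ≤ ∑ xs g
  ∑-mono []       f≤g = ≤-refl
  ∑-mono (x ∷ xs) f≤g = +-mono-≤ (f≤g x) (∑-mono xs f≤g)

  ∑-cong : ∀ (xs : List A) {f g} → (∀ x → f x ≈ g x) → ∑ xs f ≈ ∑ xs g
  ∑-cong xs f≈g = ≤-antisym (∑-mono xs λ x → ≤-reflexive (f≈g x)) (∑-mono xs λ x → ≤-reflexive (sym (f≈g x)))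

  ∑-0 : ∀ (xs : List A) → ∑ xs (λ _ → 0#) ≈ 0#
  ∑-0 []       = refl
  ∑-0 (x ∷ xs) = trans (+-identityˡ _) (∑-0 xs)

  ∑-nonNeg : ∀ (xs : List A) {f} → (∀ x → 0# ≤ f x) → 0# ≤ ∑ xs f
  ∑-nonNeg xs 0≤f = ≤-trans (≤-reflexive (sym (∑-0 xs))) (∑-mono xs 0≤f)

  ∑-+ : ∀ (xs : List A) f g → ∑ xs (λ x → f x + g x) ≈ ∑ xs f + ∑ xs g
  ∑-+ []       f g = sym (+-identityˡ 0#)
  ∑-+ (x ∷ xs) f g = trans (+-congˡ (∑-+ xs f g))
    (solve 4 (λ a b c d → a :+ b :+ (c :+ d) := a :+ c :+ (b :+ d)) refl _ _ _ _)

  ∑-*ˡ : ∀ (xs : List A) k f → ∑ xs (λ x → k * f x) ≈ k * ∑ xs f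
  ∑-*ˡ []       k f = sym (zeroʳ k)
  ∑-*ˡ (x ∷ xs) k f = trans (+-congˡ (∑-*ˡ xs k f))
    (solve 3 (λ k a b → k :* a :+ k :* b := k :* (a :+ b)) refl _ _ _)

  ∑-++-map : ∀ {B : Set} (xs ys : List A) {g h : A → B} f →
             ∑ (map g xs ++ map h ys) f ≈ ∑ xs (f ∘ g) + ∑ ys (f ∘ h)
  ∑-++-map []       []       f = sym (+-identityˡ 0#)
  ∑-++-map []       (y ∷ ys) {g} f = trans (+-congˡ (∑-++-map [] ys {g} f))
    (solve 2 (λ a b → a :+ (con (+ 0) :+ b) := con (+ 0) :+ (a :+ b)) refl _ _)
  ∑-++-map (x ∷ xs) ys       f = trans (+-congˡ (∑-++-map xs ys f))
    (solve 3 (λ a b c → a :+ (b :+ c) := a :+ b :+ c) refl _ _ _)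

  ∈⇒≤∑ : ∀ {xs : List A} {x f} → (∀ x → 0# ≤ f x) → x ∈ xs → f x ≤ ∑ xs f
  ∈⇒≤∑ {xs = y ∷ ys} 0≤f (here ≡.refl) = ≤-by _ (∑-nonNeg ys 0≤f) refl
  ∈⇒≤∑ {xs = y ∷ ys} 0≤f (there x∈ys)  = ≤-trans (∈⇒≤∑ 0≤f x∈ys) (≤-by _ (0≤f y)
    (solve 2 (λ a b → a :+ b := b :+ a) refl _ _))

  𝔼 : ℝ → (Subset m → ℝ) → ℝ
  𝔼 {m} p f = ∑ (subsets m) (λ ω → weight p ω * f ω)

  𝔼-suc : ∀ p (f : Subset (suc m) → ℝ) →
          𝔼 p f ≈ p * 𝔼 p (f ∘ (true ∷_)) + (1# - p) * 𝔼 p (f ∘ (false ∷_))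
  𝔼-suc {m} p f = trans (∑-++-map (subsets m) (subsets m) _) (+-cong (factor p _) (factor (1# - p) _))
    where
    factor : ∀ q (g : Subset m → ℝ) →
             ∑ (subsets m) (λ ω → q * weight p ω * g ω) ≈ q * 𝔼 p g
    factor q g = trans
      (∑-cong (subsets m) λ ω → solve 3 (λ q w g → q :* w :* g := q :* (w :* g)) refl q (weight p ω) (g ω))
      (∑-*ˡ (subsets m) q _)

  𝔼-const : ∀ p a → 𝔼 {m} p (λ _ → a) ≈ a
  𝔼-const {zero}  p a = solve 1 (λ a → con (+ 1) :* a :+ con (+ 0) := a) refl a
  𝔼-const {suc m} p a = begin-equality
    𝔼 {suc m} p (λ _ → a)                                    ≈⟨ 𝔼-suc {m} p _ ⟩
    p * 𝔼 {m} p (λ _ → a) + (1# - p) * 𝔼 {m} p (λ _ → a)     ≈⟨ +-cong (*-congˡ (𝔼-const {m} p a)) (*-congˡ (𝔼-const {m} p a)) ⟩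
    p * a + (1# - p) * a                                     ≈⟨ solve 2 (λ p a → p :* a :+ (con (+ 1) :- p) :* a := a) refl p a ⟩
    a                                                        ∎

  𝔼-+ : ∀ p (f g : Subset m → ℝ) → 𝔼 p (λ ω → f ω + g ω) ≈ 𝔼 p f + 𝔼 p g
  𝔼-+ {m} p f g = trans
    (∑-cong (subsets m) λ ω → solve 3 (λ w a b → w :* (a :+ b) := w :* a :+ w :* b) refl _ _ _)
    (∑-+ (subsets m) _ _)

  𝔼-*ˡ : ∀ p k (f : Subset m → ℝ) → 𝔼 p (λ ω → k * f ω) ≈ k * 𝔼 p f
  𝔼-*ˡ {m} p k f = trans
    (∑-cong (subsets m) λ ω → solve 3 (λ w k a → w :* (k :* a) := k :* (w :* a)) refl _ _ _)
    (∑-*ˡ (subsets m) k _)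

  𝔼-∑ : ∀ p (xs : List A) (f : A → Subset m → ℝ) →
        𝔼 p (λ ω → ∑ xs (λ x → f x ω)) ≈ ∑ xs (λ x → 𝔼 p (f x))
  𝔼-∑ {m = m} p []       f = 𝔼-const {m} p 0#
  𝔼-∑ {m = m} p (x ∷ xs) f = trans (𝔼-+ {m} p (f x) _) (+-congˡ (𝔼-∑ p xs f))

  module _ {p : ℝ} (0≤p : 0# ≤ p) (p≤1 : p ≤ 1#) where

    private
      0≤1-p : 0# ≤ 1# - p
      0≤1-p = x≤y⇒0≤y-x p≤1

    weight-nonNeg : (ω : Subset m) → 0# ≤ weight p ω
    weight-nonNeg []          = 0≤1
    weight-nonNeg (true  ∷ ω) = *-nonNeg 0≤p (weight-nonNeg ω)
    weight-nonNeg (false ∷ ω) = *-nonNeg 0≤1-p (weight-nonNeg ω)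

    -- The hypotheses say that `f` lies below the indicator of `E`; `f` may be negative, as 1 minus
    -- a total failure weight will be.
    𝔼≤Pr : {E : Pred (Subset m) 0ℓ} (E? : Decidable E) (f : Subset m → ℝ) →
           (∀ ω → f ω ≤ 1#) → (∀ ω → ¬ E ω → f ω ≤ 0#) → 𝔼 p f ≤ Pr p E?
    𝔼≤Pr {m} E? f f≤1 f≤0 = go (subsets m)
      where
      go : ∀ ωs → ∑ ωs (λ ω → weight p ω * f ω) ≤ ∑ (filter E? ωs) (weight p)
      go []       = ≤-refl
      go (ω ∷ ωs) with E? ω
      ... | yes _ = +-mono-≤ (≤-trans (*-monoˡ-≤ (weight-nonNeg ω) (f≤1 ω)) (≤-reflexive (*-identityʳ _))) (go ωs)
      ... | no ¬e = ≤-trans (+-mono-≤ (≤-trans (*-monoˡ-≤ (weight-nonNeg ω) (f≤0 ω ¬e)) (≤-reflexive (zeroʳ _))) (go ωs))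
                      (≤-reflexive (+-identityˡ _))

    weight≤Pr : {E : Pred (Subset m) 0ℓ} (E? : Decidable E) {ω : Subset m} → E ω → weight p ω ≤ Pr p E?
    weight≤Pr {m} E? {ω} e = ∈⇒≤∑ weight-nonNeg (∈-filter⁺ E? (subsets-complete ω) e)

    module _ {P : Pred A 0ℓ} (P? : Decidable P) (θ : ℝ) where

      -- Each element satisfying `P` multiplies the moment by 1 + p (e^θ - 1), which is at most e^(p
      -- (e^θ - 1)). The shift `s` is general so that a sampled head can pass its `θ` into the
      -- induction hypothesis as `θ + s`.
      𝔼-exp-≤ : ∀ xs s → 𝔼 p (λ ω → exp (θ * fromℕ (count P? (select xs ω)) + s))
                       ≤ exp (p * (exp θ - 1#) * fromℕ (count P? xs) + s)
      𝔼-exp-≤ [] s = ≤-reflexive (begin-equality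
        1# * exp (θ * 0# + s) + 0#         ≈⟨ solve 1 (λ e → con (+ 1) :* e :+ con (+ 0) := e) refl _ ⟩
        exp (θ * 0# + s)                   ≈⟨ exp-cong (solve 3 (λ θ s q → θ :* con (+ 0) :+ s := q :* con (+ 0) :+ s) refl θ s _) ⟩
        exp (p * (exp θ - 1#) * 0# + s)    ∎)
      𝔼-exp-≤ (x ∷ xs) s = ≤-trans (≤-reflexive (𝔼-suc {length xs} p _)) step
        where
        q = p * (exp θ - 1#)
        N = fromℕ (count P? xs)
        step : p * 𝔼 p (λ ω → exp (θ * fromℕ (count P? (x ∷ select xs ω)) + s))
             + (1# - p) * 𝔼 p (λ ω → exp (θ * fromℕ (count P? (select xs ω)) + s))
             ≤ exp (q * fromℕ (count P? (x ∷ xs)) + s)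
        step with does (P? x)
        ... | false = begin
          p * 𝔼 p f + (1# - p) * 𝔼 p f   ≈⟨ solve 2 (λ p a → p :* a :+ (con (+ 1) :- p) :* a := a) refl p _ ⟩
          𝔼 p f                          ≤⟨ 𝔼-exp-≤ xs s ⟩
          exp (q * N + s)                ∎
          where
          f : Subset (length xs) → ℝ
          f ω = exp (θ * fromℕ (count P? (select xs ω)) + s)
        ... | true = begin
          p * 𝔼 p (λ ω → exp (θ * (1# + X ω) + s)) + (1# - p) * 𝔼 p (λ ω → exp (θ * X ω + s))
            ≤⟨ +-mono-≤ (*-monoˡ-≤ 0≤p shifted) (*-monoˡ-≤ 0≤1-p (𝔼-exp-≤ xs s)) ⟩
          p * exp (q * N + (θ + s)) + (1# - p) * exp (q * N + s)
            ≈⟨ +-congʳ (*-congˡ split) ⟩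
          p * (exp θ * exp (q * N + s)) + (1# - p) * exp (q * N + s)
            ≈⟨ solve 3 (λ p e a → p :* (e :* a) :+ (con (+ 1) :- p) :* a := a :* (con (+ 1) :+ p :* (e :- con (+ 1)))) refl p _ _ ⟩
          exp (q * N + s) * (1# + q)
            ≤⟨ *-monoˡ-≤ (exp-nonNeg _) (1+x≤exp q) ⟩
          exp (q * N + s) * exp q
            ≈⟨ exp-+ _ _ ⟨
          exp (q * N + s + q)
            ≈⟨ exp-cong (solve 3 (λ q N s → q :* N :+ s :+ q := q :* (con (+ 1) :+ N) :+ s) refl q N s) ⟩
          exp (q * (1# + N) + s) ∎
          where
          X : Subset (length xs) → ℝ
          X ω = fromℕ (count P? (select xs ω))
          shifted : 𝔼 p (λ ω → exp (θ * (1# + X ω) + s)) ≤ exp (q * N + (θ + s))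
          shifted = ≤-trans
            (≤-reflexive (∑-cong (subsets (length xs)) λ ω → *-congˡ (exp-cong
              (solve 3 (λ θ X s → θ :* (con (+ 1) :+ X) :+ s := θ :* X :+ (θ :+ s)) refl θ (X ω) s))))
            (𝔼-exp-≤ xs (θ + s))
          split : exp (q * N + (θ + s)) ≈ exp θ * exp (q * N + s)
          split = trans (exp-cong (solve 3 (λ a θ s → a :+ (θ :+ s) := θ :+ (a :+ s)) refl (q * N) θ s)) (exp-+ _ _)

-- Chernoff tails with rational constants

module Tails (R : RealNumbers) where
  open RealNumbers R
  open OrderedField R
  open Probability R
  open ≤-Reasoning

  -- A common denominator of all exponents below.
  τ : ℝ
  τ = fromℕ 192 ⁻¹

  192τ≈1 : fromℕ 192 * τ ≈ 1#
  192τ≈1 = *-inverse (fromℕ-pos {192} ℕ.z<s)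

  0≤τ : 0# ≤ τ
  0≤τ = ⁻¹-nonNeg (fromℕ-pos {192} ℕ.z<s)

  *-vanish : ∀ {x y} → x ≈ y → ∀ z → z * (x - y) ≈ 0#
  *-vanish {x} {y} x≈y z = trans (*-congˡ (+-congʳ x≈y)) (solve 2 (λ y z → z :* (y :- y) := con (+ 0)) refl y z)

  -- To the solver `τ` is an indeterminate, so identities are proved modulo 192τ - 1; `z` is the
  -- explicit cofactor.
  ≈-mod-τ : ∀ {x y} z → x ≈ y + z * (fromℕ 192 * τ - 1#) → x ≈ y
  ≈-mod-τ z x≈y = trans x≈y (trans (+-congˡ (*-vanish 192τ≈1 z)) (+-identityʳ _))

  exp-4* : ∀ x → exp (fromℕ 4 * x) ≈ exp x * exp x * (exp x * exp x)
  exp-4* x = begin-equality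
    exp (fromℕ 4 * x)                ≈⟨ exp-cong (solve 1 (λ x → con (+ 4) :* x := x :+ x :+ (x :+ x)) refl x) ⟩
    exp (x + x + (x + x))            ≈⟨ exp-+ _ _ ⟩
    exp (x + x) * exp (x + x)        ≈⟨ *-cong (exp-+ x x) (exp-+ x x) ⟩
    exp x * exp x * (exp x * exp x)  ∎

  -- e^(4x) = (e^(−x))^(−4) ≤ (b/a)⁴ ≤ r/192.
  exp-4*-≤ : ∀ a b r x → 0 ℕ.< a → 192 ℕ.* (b ℕ.* b ℕ.* (b ℕ.* b)) ℕ.≤ r ℕ.* (a ℕ.* a ℕ.* (a ℕ.* a)) →
             fromℕ a ≤ fromℕ b * exp (- x) → exp (fromℕ 4 * x) ≤ fromℕ r * τ
  exp-4*-≤ a b r x 0<a 192b⁴≤ra⁴ a≤be⁻ = *-cancelˡ-≤ 0<a⁴ (begin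
    a⁴ * exp (fromℕ 4 * x)             ≈⟨ *-congˡ (exp-4* x) ⟩
    a⁴ * (e * e * (e * e))             ≈⟨ solve 2 (λ a e → a :* a :* (a :* a) :* (e :* e :* (e :* e)) := a :* e :* (a :* e) :* (a :* e :* (a :* e))) refl a′ e ⟩
    ae * ae * (ae * ae)                ≤⟨ square-mono (*-nonNeg 0≤ae 0≤ae) (square-mono 0≤ae ae≤b) ⟩
    b⁴                                 ≈⟨ ≈-mod-τ (- b⁴) (solve 3 (λ q b τ → b := τ :* (q :* b) :+ (:- b) :* (q :* τ :- con (+ 1))) refl (fromℕ 192) b⁴ τ) ⟩
    τ * (fromℕ 192 * b⁴)               ≤⟨ *-monoˡ-≤ 0≤τ 192b⁴≤ra⁴′ ⟩
    τ * (fromℕ r * a⁴)                 ≈⟨ solve 3 (λ τ r a → τ :* (r :* a) := a :* (r :* τ)) refl τ (fromℕ r) a⁴ ⟩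
    a⁴ * (fromℕ r * τ)                 ∎)
    where
    e  = exp x
    a′ = fromℕ a
    b′ = fromℕ b
    ae = a′ * e
    a⁴ = a′ * a′ * (a′ * a′)
    b⁴ = b′ * b′ * (b′ * b′)
    0<a⁴ : 0# < a⁴
    0<a⁴ = *-pos (*-pos 0<a′ 0<a′) (*-pos 0<a′ 0<a′)
      where 0<a′ = fromℕ-pos 0<a
    0≤ae : 0# ≤ ae
    0≤ae = *-nonNeg (fromℕ-nonNeg a) (exp-nonNeg x)
    ae≤b : ae ≤ b′
    ae≤b = begin
      a′ * e                  ≈⟨ *-comm _ _ ⟩
      e * a′                  ≤⟨ *-monoˡ-≤ (exp-nonNeg x) a≤be⁻ ⟩
      e * (b′ * exp (- x))    ≈⟨ solve 3 (λ e b f → e :* (b :* f) := b :* (e :* f)) refl e b′ (exp (- x)) ⟩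
      b′ * (e * exp (- x))    ≈⟨ *-congˡ (exp-inverse x) ⟩
      b′ * 1#                 ≈⟨ *-identityʳ b′ ⟩
      b′                      ∎
    square-mono : ∀ {x y} → 0# ≤ x → x ≤ y → x * x ≤ y * y
    square-mono 0≤x x≤y = *-mono-≤ 0≤x (≤-trans 0≤x x≤y) x≤y x≤y
    fromℕ-⁴ : ∀ q k → fromℕ (q ℕ.* (k ℕ.* k ℕ.* (k ℕ.* k))) ≈ fromℕ q * (fromℕ k * fromℕ k * (fromℕ k * fromℕ k))
    fromℕ-⁴ q k = trans (fromℕ-* q _) (*-congˡ (trans (fromℕ-* (k ℕ.* k) (k ℕ.* k)) (*-cong (fromℕ-* k k) (fromℕ-* k k))))
    192b⁴≤ra⁴′ : fromℕ 192 * b⁴ ≤ fromℕ r * a⁴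
    192b⁴≤ra⁴′ = ≤-trans (≤-reflexive (sym (fromℕ-⁴ 192 b))) (≤-trans (fromℕ-mono 192b⁴≤ra⁴) (≤-reflexive (fromℕ-⁴ r a)))

  -- As 24τ = 1/8, this reads e^(1/2) ≤ 328/192 and rests on 7/8 ≤ e^(-1/8). The numerator 328 is
  -- the least that (8/7)⁴ permits.
  exp-½≤ : exp (fromℕ 4 * (fromℕ 24 * τ)) ≤ fromℕ 328 * τ
  exp-½≤ = exp-4*-≤ 7 8 328 (fromℕ 24 * τ) ℕ.z<s (ℕ.≤ᵇ⇒≤ _ _ tt) (begin
    fromℕ 7                                 ≈⟨ ≈-mod-τ 1# (solve 1 (λ τ → con (+ 7) := con (+ 8) :* (con (+ 1) :- con (+ 24) :* τ) :+ con (+ 1) :* (con (+ 192) :* τ :- con (+ 1))) refl τ) ⟩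
    fromℕ 8 * (1# - fromℕ 24 * τ)           ≤⟨ *-monoˡ-≤ (fromℕ-nonNeg 8) (1+x≤exp _) ⟩
    fromℕ 8 * exp (- (fromℕ 24 * τ))        ∎)

  -- As 36τ = 3/16, this reads e^(-3/4) ≤ 97/192 and rests on 19/16 ≤ e^(3/16).
  exp-¾≤ : exp (fromℕ 4 * - (fromℕ 36 * τ)) ≤ fromℕ 97 * τ
  exp-¾≤ = exp-4*-≤ 19 16 97 (- (fromℕ 36 * τ)) ℕ.z<s (ℕ.≤ᵇ⇒≤ _ _ tt) (begin
    fromℕ 19                                ≈⟨ ≈-mod-τ (- fromℕ 3) (solve 1 (λ τ → con (+ 19) := con (+ 16) :* (con (+ 1) :- :- (con (+ 36) :* τ)) :+ (:- con (+ 3)) :* (con (+ 192) :* τ :- con (+ 1))) refl τ) ⟩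
    fromℕ 16 * (1# - - (fromℕ 36 * τ))      ≤⟨ *-monoˡ-≤ (fromℕ-nonNeg 16) (1+x≤exp _) ⟩
    fromℕ 16 * exp (- - (fromℕ 36 * τ))     ∎)

  -- For a sum X of independent indicators with mean D ≤ B, Markov's inequality bounds
  -- the probabilities of X ≥ 7/4 B and X ≤ 7/16 D through the exponents (X - 7/4 B)/2 and
  -- 3/4 (7/16 D - X).  The summands (B - M)/6 and (D - M)/6 weaken both bounds to e^(−M/6),
  -- and make the lower one vacuous if D < M.
  upper : ℝ → ℝ → ℝ → ℝ
  upper X B M = fromℕ 24 * τ * (fromℕ 4 * X - fromℕ 7 * B) + fromℕ 32 * τ * (B - M)

  lower : ℝ → ℝ → ℝ → ℝ
  lower X D M = fromℕ 9 * τ * (fromℕ 7 * D - fromℕ 16 * X) + fromℕ 32 * τ * (D - M)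

  -- If y ≤ x, both summands of the exponent are nonnegative and the exponential is at least 1. In
  -- this sense the exponential dominates the indicator of failure.
  weighted-exp<1⇒< : ∀ {x y d} k → 0# ≤ d → exp (fromℕ k * τ * (x - y) + fromℕ 32 * τ * d) < 1# → x < y
  weighted-exp<1⇒< {x} {y} k 0≤d e<1 = ≰⇒> λ y≤x → ≤⇒≯ (+-nonNeg
    (*-nonNeg (*-nonNeg (fromℕ-nonNeg k) 0≤τ) (x≤y⇒0≤y-x y≤x))
    (*-nonNeg (*-nonNeg (fromℕ-nonNeg 32) 0≤τ) 0≤d)) (exp<1⇒<0 e<1)

  upper⇒< : ∀ {X B M} → M ≤ B → exp (upper X B M) < 1# → fromℕ 4 * X < fromℕ 7 * B
  upper⇒< {X} {B} {M} M≤B = weighted-exp<1⇒< 24 (x≤y⇒0≤y-x M≤B)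

  lower⇒< : ∀ {X D M} → M ≤ D → exp (lower X D M) < 1# → fromℕ 7 * D < fromℕ 16 * X
  lower⇒< {X} {D} {M} M≤D = weighted-exp<1⇒< 9 (x≤y⇒0≤y-x M≤D)

  module _ {p : ℝ} (0≤p : 0# ≤ p) (p≤1 : p ≤ 1#)
           {P : Pred A 0ℓ} (P? : Decidable P) (xs : List A) where

    private
      N = fromℕ (count P? xs)
      X : Subset (length xs) → ℝ
      X ω = fromℕ (count P? (select xs ω))
      0≤D : 0# ≤ p * N
      0≤D = *-nonNeg 0≤p (fromℕ-nonNeg (count P? xs))

    -- `B` may exceed the mean D, as it does for sparse cuts. In units of 1/192 the moment bound
    -- gives at most (328 - 192) D = 136 D and the shift gives -168 B + 32 (B - M), which leaves
    -- -136 (B - D) - 32 M.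
    𝔼-upper : ∀ {B M} → p * N ≤ B → 𝔼 p (λ ω → exp (upper (X ω) B M)) ≤ exp (- (fromℕ 32 * τ * M))
    𝔼-upper {B} {M} D≤B = begin
      𝔼 p (λ ω → exp (upper (X ω) B M))
        ≈⟨ ∑-cong (subsets (length xs)) (λ ω → *-congˡ (exp-cong (solve 4 (λ τ X B M →
             con (+ 24) :* τ :* (con (+ 4) :* X :- con (+ 7) :* B) :+ con (+ 32) :* τ :* (B :- M)
             := con (+ 4) :* (con (+ 24) :* τ) :* X :+ (con (+ 32) :* τ :* (B :- M) :- con (+ 168) :* τ :* B))
             refl τ (X ω) B M))) ⟩
      𝔼 p (λ ω → exp (θ * X ω + s))        ≤⟨ 𝔼-exp-≤ 0≤p p≤1 P? θ xs s ⟩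
      exp (p * (exp θ - 1#) * N + s)       ≤⟨ exp-mono (≤-by _ (+-nonNeg (*-nonNeg 0≤D (x≤y⇒0≤y-x exp-½≤)) (*-nonNeg (*-nonNeg (fromℕ-nonNeg 136) 0≤τ) (x≤y⇒0≤y-x D≤B)))
           (≈-mod-τ (- (p * N)) (solve 6 (λ τ p N e B M →
             :- (con (+ 32) :* τ :* M)
             := p :* (e :- con (+ 1)) :* N :+ (con (+ 32) :* τ :* (B :- M) :- con (+ 168) :* τ :* B)
                :+ (p :* N :* (con (+ 328) :* τ :- e) :+ con (+ 136) :* τ :* (B :- p :* N))
                :+ (:- (p :* N)) :* (con (+ 192) :* τ :- con (+ 1)))
             refl τ p N (exp θ) B M))) ⟩
      exp (- (fromℕ 32 * τ * M))           ∎
      where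
      θ = fromℕ 4 * (fromℕ 24 * τ)
      s = fromℕ 32 * τ * (B - M) - fromℕ 168 * τ * B

    -- In units of 1/192 the moment bound gives at most (97 - 192) D = -95 D. This cancels the 63 D
    -- + 32 D of the shift exactly and leaves -32 M.
    𝔼-lower : ∀ {M} → 𝔼 p (λ ω → exp (lower (X ω) (p * N) M)) ≤ exp (- (fromℕ 32 * τ * M))
    𝔼-lower {M} = begin
      𝔼 p (λ ω → exp (lower (X ω) (p * N) M))
        ≈⟨ ∑-cong (subsets (length xs)) (λ ω → *-congˡ (exp-cong (solve 4 (λ τ X D M →
             con (+ 9) :* τ :* (con (+ 7) :* D :- con (+ 16) :* X) :+ con (+ 32) :* τ :* (D :- M)
             := con (+ 4) :* (:- (con (+ 36) :* τ)) :* X :+ (con (+ 95) :* τ :* D :- con (+ 32) :* τ :* M))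
             refl τ (X ω) (p * N) M))) ⟩
      𝔼 p (λ ω → exp (θ * X ω + s))        ≤⟨ 𝔼-exp-≤ 0≤p p≤1 P? θ xs s ⟩
      exp (p * (exp θ - 1#) * N + s)       ≤⟨ exp-mono (≤-by _ (*-nonNeg 0≤D (x≤y⇒0≤y-x exp-¾≤))
           (≈-mod-τ (- (p * N)) (solve 5 (λ τ p N e M →
             :- (con (+ 32) :* τ :* M)
             := p :* (e :- con (+ 1)) :* N :+ (con (+ 95) :* τ :* (p :* N) :- con (+ 32) :* τ :* M)
                :+ p :* N :* (con (+ 97) :* τ :- e)
                :+ (:- (p :* N)) :* (con (+ 192) :* τ :- con (+ 1)))
             refl τ p N (exp θ) M))) ⟩
      exp (- (fromℕ 32 * τ * M))           ∎
      where
      θ = fromℕ 4 * - (fromℕ 36 * τ)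
      s = fromℕ 95 * τ * (p * N) - fromℕ 32 * τ * M

-- Degrees, volumes and cuts of edge lists

select-⊤ : (xs : List A) → select xs ⊤ ≡ xs
select-⊤ []       = ≡.refl
select-⊤ (x ∷ xs) = ≡.cong (x ∷_) (select-⊤ xs)

𝟙 : Bool → ℕ
𝟙 true  = 1
𝟙 false = 0

count-∷ : {P : Pred A 0ℓ} (P? : Decidable P) (x : A) (xs : List A) →
          count P? (x ∷ xs) ≡ 𝟙 (does (P? x)) ℕ.+ count P? xs
count-∷ P? x xs with does (P? x)
... | true  = ≡.refl
... | false = ≡.refl

-- Lets concentration at `∁ S` speak about the cut at `S` when `∁ S` is the side of smaller volume.
count-crosses-∁ : (S : Subset n) (es : List (Fin n × Fin n)) →
                  count (crosses? (∁ S)) es ≡ count (crosses? S) es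
count-crosses-∁ S es = ≡.cong length (filter-≐ (crosses? (∁ S)) (crosses? S) (to , from) es)
  where
  to : ∀ {e} → Crosses (∁ S) e → Crosses S e
  to = Sum.swap ∘ Sum.map (Product.map x∈∁p⇒x∉p x∉∁p⇒x∈p) (Product.map x∉∁p⇒x∈p x∈∁p⇒x∉p)
  from : ∀ {e} → Crosses S e → Crosses (∁ S) e
  from = Sum.swap ∘ Sum.map (Product.map x∈p⇒x∉∁p x∉p⇒x∈∁p) (Product.map x∉p⇒x∈∁p x∈p⇒x∉∁p)

sumOver : Subset n → (Fin n → ℕ) → ℕ
sumOver []          f = 0
sumOver (true  ∷ T) f = f zero ℕ.+ sumOver T (f ∘ suc)
sumOver (false ∷ T) f = sumOver T (f ∘ suc)

sumOver-cong : (T : Subset n) {f g : Fin n → ℕ} → (∀ v → f v ≡ g v) → sumOver T f ≡ sumOver T g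
sumOver-cong []          f≡g = ≡.refl
sumOver-cong (true  ∷ T) f≡g = ≡.cong₂ ℕ._+_ (f≡g zero) (sumOver-cong T (f≡g ∘ suc))
sumOver-cong (false ∷ T) f≡g = sumOver-cong T (f≡g ∘ suc)

sumOver-+ : (T : Subset n) (f g : Fin n → ℕ) →
            sumOver T (λ v → f v ℕ.+ g v) ≡ sumOver T f ℕ.+ sumOver T g
sumOver-+ []          f g = ≡.refl
sumOver-+ (false ∷ T) f g = sumOver-+ T (f ∘ suc) (g ∘ suc)
sumOver-+ (true  ∷ T) f g = ≡.trans
  (≡.cong (f zero ℕ.+ g zero ℕ.+_) (sumOver-+ T (f ∘ suc) (g ∘ suc)))
  (solve 4 (λ a b c d → a :+ b :+ (c :+ d) := a :+ c :+ (b :+ d)) ≡.refl (f zero) (g zero) _ _)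
  where open ℕ-Solver.+-*-Solver

sumOver-0 : (T : Subset n) → sumOver T (λ _ → 0) ≡ 0
sumOver-0 []          = ≡.refl
sumOver-0 (true  ∷ T) = sumOver-0 T
sumOver-0 (false ∷ T) = sumOver-0 T

sumOver-𝟙 : (T : Subset n) (a : Fin n) →
            sumOver T (λ v → 𝟙 (does (v Fin.≟ a))) ≡ 𝟙 (does (a ∈? T))
sumOver-𝟙 (true  ∷ T) zero    = ≡.cong suc (sumOver-0 T)
sumOver-𝟙 (false ∷ T) zero    = sumOver-0 T
sumOver-𝟙 (true  ∷ T) (suc a) = sumOver-𝟙 T a
sumOver-𝟙 (false ∷ T) (suc a) = sumOver-𝟙 T a

-- Edge by edge, the number of endpoints in `T` is at most twice the contribution to the volume. A
-- loop inside `T` attains equality, since it adds 2 to the degree and 1 to the volume.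
sum-degrees≤2*Vol : (G : Multigraph n) (T : Subset n) → sumOver T (degree G) ℕ.≤ 2 ℕ.* Vol G T
sum-degrees≤2*Vol {n} (multigraph es) T = go es
  where
  open ℕ.≤-Reasoning
  open ℕ-Solver.+-*-Solver

  at : Fin n → Fin n → ℕ
  at a v = 𝟙 (does (v Fin.≟ a))

  𝟙-∨ : ∀ x y → 𝟙 x ℕ.+ 𝟙 y ℕ.≤ 2 ℕ.* 𝟙 (x ∨ y)
  𝟙-∨ true  true  = ℕ.≤-refl
  𝟙-∨ true  false = ℕ.s≤s ℕ.z≤n
  𝟙-∨ false true  = ℕ.s≤s ℕ.z≤n
  𝟙-∨ false false = ℕ.z≤n

  go : ∀ es → sumOver T (degree (multigraph es)) ℕ.≤ 2 ℕ.* Vol (multigraph es) T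
  go []             = ℕ.≤-reflexive (sumOver-0 T)
  go ((a , b) ∷ es) = begin
    sumOver T (degree (multigraph ((a , b) ∷ es)))
      ≡⟨ sumOver-cong T (λ v → ≡.trans (count-∷ (v Fin.≟_) a _) (≡.cong (at a v ℕ.+_) (count-∷ (v Fin.≟_) b _))) ⟩
    sumOver T (λ v → at a v ℕ.+ (at b v ℕ.+ degree G v))
      ≡⟨ ≡.trans (sumOver-+ T (at a) _) (≡.cong (sumOver T (at a) ℕ.+_) (sumOver-+ T (at b) (degree G))) ⟩
    sumOver T (at a) ℕ.+ (sumOver T (at b) ℕ.+ sumOver T (degree G))
      ≡⟨ ≡.cong₂ (λ x y → x ℕ.+ (y ℕ.+ sumOver T (degree G))) (sumOver-𝟙 T a) (sumOver-𝟙 T b) ⟩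
    𝟙 (does (a ∈? T)) ℕ.+ (𝟙 (does (b ∈? T)) ℕ.+ sumOver T (degree G))
      ≡⟨ ℕ.+-assoc (𝟙 (does (a ∈? T))) _ _ ⟨
    𝟙 (does (a ∈? T)) ℕ.+ 𝟙 (does (b ∈? T)) ℕ.+ sumOver T (degree G)
      ≤⟨ ℕ.+-mono-≤ (𝟙-∨ (does (a ∈? T)) (does (b ∈? T))) (go es) ⟩
    2 ℕ.* 𝟙 (does (incident? T (a , b))) ℕ.+ 2 ℕ.* Vol G T
      ≡⟨ ℕ.*-distribˡ-+ 2 (𝟙 (does (incident? T (a , b)))) _ ⟨
    2 ℕ.* (𝟙 (does (incident? T (a , b))) ℕ.+ Vol G T)
      ≡⟨ ≡.cong (2 ℕ.*_) (count-∷ (incident? T) (a , b) es) ⟨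
    2 ℕ.* Vol (multigraph ((a , b) ∷ es)) T ∎
    where
    G : Multigraph n
    G = multigraph es

-- Exponential weights summed over nonempty sets

module SubsetSums (R : RealNumbers) where
  open RealNumbers R
  open OrderedField R
  open Probability R
  open ≤-Reasoning

  sumOver-≥ : ∀ (T : Subset n) {f d} → (∀ v → d ≤ fromℕ (f v)) → fromℕ ∣ T ∣ * d ≤ fromℕ (sumOver T f)
  sumOver-≥ []          d≤f = ≤-reflexive (zeroˡ _)
  sumOver-≥ (false ∷ T) d≤f = sumOver-≥ T (d≤f ∘ suc)
  sumOver-≥ (true  ∷ T) {f} {d} d≤f = begin
    (1# + fromℕ ∣ T ∣) * d                           ≈⟨ solve 2 (λ k d → (con (+ 1) :+ k) :* d := d :+ k :* d) refl _ d ⟩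
    d + fromℕ ∣ T ∣ * d                              ≤⟨ +-mono-≤ (d≤f zero) (sumOver-≥ T (d≤f ∘ suc)) ⟩
    fromℕ (f zero) + fromℕ (sumOver T (f ∘ suc))     ≈⟨ fromℕ-+ (f zero) _ ⟨
    fromℕ (f zero ℕ.+ sumOver T (f ∘ suc))           ∎

  Vol-≥ : ∀ (G : Multigraph n) T {d} → (∀ v → d ≤ fromℕ (degree G v)) →
          fromℕ ∣ T ∣ * d ≤ fromℕ 2 * fromℕ (Vol G T)
  Vol-≥ G T {d} d≤deg = begin
    fromℕ ∣ T ∣ * d                   ≤⟨ sumOver-≥ T d≤deg ⟩
    fromℕ (sumOver T (degree G))      ≤⟨ fromℕ-mono (sum-degrees≤2*Vol G T) ⟩
    fromℕ (2 ℕ.* Vol G T)             ≈⟨ fromℕ-* 2 (Vol G T) ⟩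
    fromℕ 2 * fromℕ (Vol G T)         ∎

  module _ (ℓ : ℝ) where
    private
      x = exp (- ℓ)

    expSize : Subset n → ℝ
    expSize T = exp (- (fromℕ ∣ T ∣ * ℓ))

    expSize-true : (T : Subset n) → expSize (true ∷ T) ≈ x * expSize T
    expSize-true T = trans
      (exp-cong (solve 2 (λ k l → :- ((con (+ 1) :+ k) :* l) := :- l :+ :- (k :* l)) refl (fromℕ ∣ T ∣) ℓ))
      (exp-+ _ _)

    ∑-subsets : ∀ n → ∑ (subsets n) expSize ≈ 1# + ∑ (nonemptySubsets n) expSize
    ∑-subsets zero    = +-congʳ (trans (exp-cong (solve 1 (λ l → :- (con (+ 0) :* l) := con (+ 0)) refl ℓ)) exp-0)
    ∑-subsets (suc n) = begin-equality
      ∑ (subsets (suc n)) expSize             ≈⟨ ∑-++-map (subsets n) (subsets n) expSize ⟩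
      t + ∑ (subsets n) expSize               ≈⟨ +-congˡ (∑-subsets n) ⟩
      t + (1# + e)                            ≈⟨ solve 2 (λ t e → t :+ (con (+ 1) :+ e) := con (+ 1) :+ (t :+ e)) refl t e ⟩
      1# + (t + e)                            ≈⟨ +-congˡ (∑-++-map (subsets n) (nonemptySubsets n) expSize) ⟨
      1# + ∑ (nonemptySubsets (suc n)) expSize  ∎
      where
      t = ∑ (subsets n) (expSize ∘ (true ∷_))
      e = ∑ (nonemptySubsets n) expSize

    -- The sum is (1 + x)^n - 1. Passing from n to n + 1 turns e into x (1 + e) + e, which adds at
    -- most 2x while e ≤ 1. Only the sums before the last need that bound, hence `pred`: for n = 1
    -- the application has x = 1, where 2nx ≤ 1 would be false.
    ∑-nonemptySubsets-≤ : ∀ n → fromℕ 2 * fromℕ (ℕ.pred n) * x ≤ 1# →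
                          ∑ (nonemptySubsets n) expSize ≤ fromℕ 2 * fromℕ n * x
    ∑-nonemptySubsets-≤ zero    _     = ≤-reflexive (solve 1 (λ x → con (+ 0) := con (+ 2) :* con (+ 0) :* x) refl x)
    ∑-nonemptySubsets-≤ (suc n) 2nx≤1 = begin
      ∑ (nonemptySubsets (suc n)) expSize
        ≈⟨ ∑-++-map (subsets n) (nonemptySubsets n) expSize ⟩
      ∑ (subsets n) (expSize ∘ (true ∷_)) + e
        ≈⟨ +-congʳ (trans (∑-cong (subsets n) expSize-true) (trans (∑-*ˡ (subsets n) x expSize) (*-congˡ (∑-subsets n)))) ⟩
      x * (1# + e) + e
        ≤⟨ +-mono-≤ (*-monoˡ-≤ 0≤x (+-monoʳ-≤ 1# (≤-trans ih 2nx≤1))) ih ⟩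
      x * (1# + 1#) + fromℕ 2 * fromℕ n * x
        ≈⟨ solve 2 (λ x n → x :* (con (+ 1) :+ con (+ 1)) :+ con (+ 2) :* n :* x := con (+ 2) :* (con (+ 1) :+ n) :* x) refl x (fromℕ n) ⟩
      fromℕ 2 * fromℕ (suc n) * x ∎
      where
      e = ∑ (nonemptySubsets n) expSize
      0≤x : 0# ≤ x
      0≤x = exp-nonNeg _
      ih : e ≤ fromℕ 2 * fromℕ n * x
      ih = ∑-nonemptySubsets-≤ n (≤-trans
        (*-mono-≤ (*-nonNeg (fromℕ-nonNeg 2) (fromℕ-nonNeg (ℕ.pred n))) 0≤x
          (*-monoˡ-≤ (fromℕ-nonNeg 2) (fromℕ-mono (ℕ.pred[n]≤n {n}))) ≤-refl) 2nx≤1)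

-- From concentrated counts to conductance

module Concentration (R : RealNumbers) where
  open RealNumbers R
  open OrderedField R
  open Probability R
  open Tails R
  open SubsetSums R
  open Sampling R
  open Max totalOrder using (_⊔_; x≤y⇒x⊔y≈y; x≤y⇒y⊔x≈y)
  open Min totalOrder using (x≤y⇒x⊓y≈x; x≤y⇒y⊓x≈x)
  open ≤-Reasoning

  x≤x⊔y : ∀ x y → x ≤ x ⊔ y
  x≤x⊔y x y with ≤-total x y
  ... | inj₁ x≤y = ≤-trans x≤y (≤-reflexive (sym (x≤y⇒x⊔y≈y x≤y)))
  ... | inj₂ y≤x = ≤-reflexive (sym (x≤y⇒y⊔x≈y y≤x))

  y≤x⊔y : ∀ x y → y ≤ x ⊔ y
  y≤x⊔y x y with ≤-total x y
  ... | inj₁ x≤y = ≤-reflexive (sym (x≤y⇒x⊔y≈y x≤y))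
  ... | inj₂ y≤x = ≤-trans y≤x (≤-reflexive (sym (x≤y⇒y⊔x≈y y≤x)))

  minVol : Multigraph n → Subset n → ℕ
  minVol G S = Vol G S ℕ.⊓ Vol G (∁ S)

  Φ-nonNeg : (G : Multigraph n) (S : Subset n) → 0 ℕ.< minVol G S → 0# ≤ Φ G S
  Φ-nonNeg G S 0<W = *-≤⇒≤-/ (fromℕ-pos 0<W) (≤-trans (≤-reflexive (zeroˡ _)) (fromℕ-nonNeg (δ G S)))

  conductancePreserved-refl : ∀ {ρ} → 0# < ρ → (G : Multigraph n) (S : Subset n) →
                              HasConductance G S → ConductancePreserved ρ G G S
  conductancePreserved-refl {ρ = ρ} 0<ρ G S pos =
    (λ _ → pos , *-cancelˡ-≤ (fromℕ-pos {4} ℕ.z<s) ¼Φ≤Φ , grow 0≤Φ (fromℕ-nonNeg 3)) ,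
    (λ Φ<ρ → pos , ≤-trans (proj₁ Φ<ρ) (grow (proj₁ 0<ρ) (fromℕ-nonNeg 5)))
    where
    0≤Φ : 0# ≤ Φ G S
    0≤Φ = Φ-nonNeg G S (ℕ.⊓-pres-m< (proj₁ pos) (proj₂ pos))
    grow : ∀ {x k} → 0# ≤ x → 0# ≤ k → x ≤ (1# + k) * x
    grow {x} {k} 0≤x 0≤k = ≤-by (k * x) (*-nonNeg 0≤k 0≤x)
      (solve 2 (λ k x → (con (+ 1) :+ k) :* x := x :+ k :* x) refl k x)
    ¼Φ≤Φ : fromℕ 4 * (fromℕ 4 ⁻¹ * Φ G S) ≤ fromℕ 4 * Φ G S
    ¼Φ≤Φ = begin
      fromℕ 4 * (fromℕ 4 ⁻¹ * Φ G S)   ≈⟨ solve 3 (λ f i x → f :* (i :* x) := i :* (f :* x)) refl _ _ _ ⟩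
      fromℕ 4 ⁻¹ * (fromℕ 4 * Φ G S)   ≈⟨ *-inverse-assoc (fromℕ-pos {4} ℕ.z<s) _ ⟩
      Φ G S                            ≤⟨ grow 0≤Φ (fromℕ-nonNeg 3) ⟩
      fromℕ 4 * Φ G S                  ∎

  module _ {p ρ : ℝ} (0≤p : 0# ≤ p) (p≤1 : p ≤ 1#) (0<ρ : 0# < ρ) (ρ≤1 : ρ ≤ 1#) (G : Multigraph n) where

    -- The windows 7/16 and 7/4 with denominators cleared. `δ-lower` is conditional because a sparse
    -- cut may lose all its edges. The maximum in `δ-upper` lets one bound serve both conductance
    -- regimes.
    record Concentrated (G′ : Multigraph n) (T : Subset n) : Set where
      field
        Vol-lower : fromℕ 7 * (p * fromℕ (Vol G T)) < fromℕ 16 * fromℕ (Vol G′ T)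
        Vol-upper : fromℕ 4 * fromℕ (Vol G′ T) < fromℕ 7 * (p * fromℕ (Vol G T))
        δ-lower   : ρ * fromℕ (Vol G T) ≤ fromℕ (δ G T) →
                    fromℕ 7 * (p * fromℕ (δ G T)) < fromℕ 16 * fromℕ (δ G′ T)
        δ-upper   : fromℕ 4 * fromℕ (δ G′ T) < fromℕ 7 * (p * (fromℕ (δ G T) ⊔ ρ * fromℕ (Vol G T)))

    open Concentrated

    module _ (G′ : Multigraph n) (S : Subset n) (posG : HasConductance G S)
             (conc : Concentrated G′ S) (conc∁ : Concentrated G′ (∁ S)) where

      private
        d d′ W W′ : ℝ
        d  = fromℕ (δ G S)
        d′ = fromℕ (δ G′ S)
        W  = fromℕ (minVol G S)
        W′ = fromℕ (minVol G′ S)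

        0<W : 0# < W
        0<W = fromℕ-pos (ℕ.⊓-pres-m< (proj₁ posG) (proj₂ posG))

        -- Strictness of `Vol-lower` excludes volume 0, which is why the conductance in `G′` is
        -- defined.
        Vol′-pos : ∀ {T} → Concentrated G′ T → 0 ℕ.< Vol G′ T
        Vol′-pos {T} c = fromℕ-pos⁻¹ (fromℕ-nonNeg (Vol G′ T) , λ 0≈v′ → ≤⇒≯
          (*-nonNeg (fromℕ-nonNeg 7) (*-nonNeg 0≤p (fromℕ-nonNeg (Vol G T))))
          (begin-strict
            fromℕ 7 * (p * fromℕ (Vol G T))   <⟨ Vol-lower c ⟩
            fromℕ 16 * fromℕ (Vol G′ T)       ≈⟨ *-congˡ 0≈v′ ⟨
            fromℕ 16 * 0#                     ≈⟨ zeroʳ _ ⟩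
            0#                                ∎))

        posG′ : HasConductance G′ S
        posG′ = Vol′-pos conc , Vol′-pos conc∁

        0<W′ : 0# < W′
        0<W′ = fromℕ-pos (ℕ.⊓-pres-m< (proj₁ posG′) (proj₂ posG′))

        -- A lower bound on a minimum is checked on the side attaining it in `G′`; the upper bound
        -- `W-upper` is checked on the side attaining it in `G`.
        W-lower : fromℕ 7 * (p * W) ≤ fromℕ 16 * W′
        W-lower with ℕ.⊓-sel (Vol G′ S) (Vol G′ (∁ S))
        ... | inj₁ eq rewrite eq = ≤-trans
          (*-monoˡ-≤ (fromℕ-nonNeg 7) (*-monoˡ-≤ 0≤p (fromℕ-mono (ℕ.m⊓n≤m (Vol G S) _)))) (proj₁ (Vol-lower conc))
        ... | inj₂ eq rewrite eq = ≤-trans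
          (*-monoˡ-≤ (fromℕ-nonNeg 7) (*-monoˡ-≤ 0≤p (fromℕ-mono (ℕ.m⊓n≤n (Vol G S) _)))) (proj₁ (Vol-lower conc∁))

        W-upper : fromℕ 4 * W′ ≤ fromℕ 7 * (p * W)
        W-upper with ℕ.⊓-sel (Vol G S) (Vol G (∁ S))
        ... | inj₁ eq rewrite eq = ≤-trans
          (*-monoˡ-≤ (fromℕ-nonNeg 4) (fromℕ-mono (ℕ.m⊓n≤m (Vol G′ S) _))) (proj₁ (Vol-upper conc))
        ... | inj₂ eq rewrite eq = ≤-trans
          (*-monoˡ-≤ (fromℕ-nonNeg 4) (fromℕ-mono (ℕ.m⊓n≤n (Vol G′ S) _))) (proj₁ (Vol-upper conc∁))

        -- On the side of smaller volume in `G`, `W` is the volume itself, so the premise is exactly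
        -- that of `δ-lower` there.
        d-lower : ρ * W ≤ d → fromℕ 7 * (p * d) ≤ fromℕ 16 * d′
        d-lower with ℕ.⊓-sel (Vol G S) (Vol G (∁ S))
        ... | inj₁ eq rewrite eq = proj₁ ∘ δ-lower conc
        ... | inj₂ eq rewrite eq | ≡.sym (count-crosses-∁ S (edges G)) | ≡.sym (count-crosses-∁ S (edges G′)) =
          proj₁ ∘ δ-lower conc∁

        d-upper : fromℕ 4 * d′ ≤ fromℕ 7 * (p * (d ⊔ ρ * W))
        d-upper with ℕ.⊓-sel (Vol G S) (Vol G (∁ S))
        ... | inj₁ eq rewrite eq = proj₁ (δ-upper conc)
        ... | inj₂ eq rewrite eq | ≡.sym (count-crosses-∁ S (edges G)) | ≡.sym (count-crosses-∁ S (edges G′)) =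
          proj₁ (δ-upper conc∁)

        Φ*W≈d : Φ G S * W ≈ d
        Φ*W≈d = /-* 0<W

        d-upper′ : ∀ {b} → d ⊔ ρ * W ≈ b → fromℕ 4 * d′ ≤ fromℕ 7 * (p * b)
        d-upper′ eq = ≤-trans d-upper (≤-reflexive (*-congˡ (*-congˡ eq)))

        0<4 : 0# < fromℕ 4
        0<4 = fromℕ-pos {4} ℕ.z<s

        large : ρ ≤ Φ G S → HasConductance G′ S × DeviatesAtMost (fromℕ 4) (Φ G S) (Φ G′ S)
        large ρ≤Φ = posG′ , *-≤⇒≤-/ 0<W′ (*-cancelˡ-≤ (*-pos 0<4 (*-pos 0<4 0<W)) lo) ,
                            ≤-*⇒/-≤ 0<W′ (*-cancelˡ-≤ (*-pos 0<4 0<W) up)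
          where
          ρW≤d : ρ * W ≤ d
          ρW≤d = begin
            ρ * W        ≈⟨ *-comm ρ W ⟩
            W * ρ        ≤⟨ *-monoˡ-≤ (proj₁ 0<W) ρ≤Φ ⟩
            W * Φ G S    ≈⟨ *-comm W _ ⟩
            Φ G S * W    ≈⟨ Φ*W≈d ⟩
            d            ∎
          0≤d : 0# ≤ d
          0≤d = fromℕ-nonNeg (δ G S)
          -- The factor 16 W clears both the 1/4 and the denominator of `Φ G S`. The product 7p is
          -- carried from the volume window to the cut window and never divided out.
          lo : fromℕ 4 * (fromℕ 4 * W) * (fromℕ 4 ⁻¹ * Φ G S * W′) ≤ fromℕ 4 * (fromℕ 4 * W) * d′
          lo = begin
            fromℕ 4 * (fromℕ 4 * W) * (fromℕ 4 ⁻¹ * Φ G S * W′)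
              ≈⟨ solve 5 (λ f i W Φ W′ → f :* (f :* W) :* (i :* Φ :* W′) := f :* i :* (Φ :* W) :* (f :* W′)) refl (fromℕ 4) (fromℕ 4 ⁻¹) W (Φ G S) W′ ⟩
            fromℕ 4 * fromℕ 4 ⁻¹ * (Φ G S * W) * (fromℕ 4 * W′)
              ≈⟨ *-congʳ (*-cong (*-inverse 0<4) Φ*W≈d) ⟩
            1# * d * (fromℕ 4 * W′)
              ≈⟨ *-congʳ (*-identityˡ d) ⟩
            d * (fromℕ 4 * W′)
              ≤⟨ *-monoˡ-≤ 0≤d W-upper ⟩
            d * (fromℕ 7 * (p * W))
              ≈⟨ solve 4 (λ d s p W → d :* (s :* (p :* W)) := W :* (s :* (p :* d))) refl d (fromℕ 7) p W ⟩
            W * (fromℕ 7 * (p * d))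
              ≤⟨ *-monoˡ-≤ (proj₁ 0<W) (d-lower ρW≤d) ⟩
            W * (fromℕ 16 * d′)
              ≈⟨ solve 2 (λ W d → W :* (con (+ 16) :* d) := con (+ 4) :* (con (+ 4) :* W) :* d) refl W d′ ⟩
            fromℕ 4 * (fromℕ 4 * W) * d′ ∎
          up : fromℕ 4 * W * d′ ≤ fromℕ 4 * W * (fromℕ 4 * Φ G S * W′)
          up = begin
            fromℕ 4 * W * d′                ≈⟨ solve 3 (λ f W d → f :* W :* d := W :* (f :* d)) refl (fromℕ 4) W d′ ⟩
            W * (fromℕ 4 * d′)              ≤⟨ *-monoˡ-≤ (proj₁ 0<W) (d-upper′ (x≤y⇒y⊔x≈y ρW≤d)) ⟩
            W * (fromℕ 7 * (p * d))         ≈⟨ solve 4 (λ d s p W → W :* (s :* (p :* d)) := d :* (s :* (p :* W))) refl d (fromℕ 7) p W ⟩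
            d * (fromℕ 7 * (p * W))         ≤⟨ *-monoˡ-≤ 0≤d W-lower ⟩
            d * (fromℕ 16 * W′)             ≈⟨ *-congʳ Φ*W≈d ⟨
            Φ G S * W * (fromℕ 16 * W′)     ≈⟨ solve 3 (λ Φ W W′ → Φ :* W :* (con (+ 16) :* W′) := con (+ 4) :* W :* (con (+ 4) :* Φ :* W′)) refl (Φ G S) W W′ ⟩
            fromℕ 4 * W * (fromℕ 4 * Φ G S * W′) ∎

        -- The maximum in `δ-upper` is now ρ W, so the windows already give 4ρ; the last inequality
        -- gives away the slack up to 6ρ.
        small : Φ G S < ρ → HasConductance G′ S × Φ G′ S ≤ fromℕ 6 * ρ
        small (Φ≤ρ , _) = posG′ , ≤-*⇒/-≤ 0<W′ (*-cancelˡ-≤ 0<4 (begin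
          fromℕ 4 * d′                   ≤⟨ d-upper′ (x≤y⇒x⊔y≈y d≤ρW) ⟩
          fromℕ 7 * (p * (ρ * W))        ≈⟨ solve 4 (λ s p ρ W → s :* (p :* (ρ :* W)) := ρ :* (s :* (p :* W))) refl (fromℕ 7) p ρ W ⟩
          ρ * (fromℕ 7 * (p * W))        ≤⟨ *-monoˡ-≤ (proj₁ 0<ρ) W-lower ⟩
          ρ * (fromℕ 16 * W′)            ≤⟨ ≤-by _ (*-nonNeg (fromℕ-nonNeg 8) (*-nonNeg (proj₁ 0<ρ) (proj₁ 0<W′)))
                                              (solve 2 (λ ρ W → con (+ 4) :* (con (+ 6) :* ρ :* W) := ρ :* (con (+ 16) :* W) :+ con (+ 8) :* (ρ :* W)) refl ρ W′) ⟩
          fromℕ 4 * (fromℕ 6 * ρ * W′)   ∎))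
          where
          d≤ρW : d ≤ ρ * W
          d≤ρW = begin
            d            ≈⟨ Φ*W≈d ⟨
            Φ G S * W    ≈⟨ *-comm _ W ⟩
            W * Φ G S    ≤⟨ *-monoˡ-≤ (proj₁ 0<W) Φ≤ρ ⟩
            W * ρ        ≈⟨ *-comm W ρ ⟩
            ρ * W        ∎

      concentrated⇒preserved : ConductancePreserved ρ G G′ S
      concentrated⇒preserved = large , small

    threshold : Subset n → ℝ
    threshold T = p * (ρ * fromℕ (Vol G T))

    δ-threshold : Subset n → ℝ
    δ-threshold T = p * (fromℕ (δ G T) ⊔ ρ * fromℕ (Vol G T))

    -- The terms are nonnegative, so a value below 1 keeps each of the four exponentials below 1,
    -- one for each field of `Concentrated`.
    failure : Subset n → Subset (∣E∣ G) → ℝ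
    failure T ω =
      (exp (lower v (p * fromℕ (Vol G T)) M) + exp (upper v (p * fromℕ (Vol G T)) M)) +
      (exp (lower d (p * fromℕ (δ G T)) M) + exp (upper d (δ-threshold T) M))
      where
      v = fromℕ (Vol (sampled G ω) T)
      d = fromℕ (δ (sampled G ω) T)
      M = threshold T

    failure-nonNeg : ∀ T ω → 0# ≤ failure T ω
    failure-nonNeg T ω =
      +-nonNeg (+-nonNeg (exp-nonNeg _) (exp-nonNeg _)) (+-nonNeg (exp-nonNeg _) (exp-nonNeg _))

    failure<1⇒concentrated : ∀ T ω → failure T ω < 1# → Concentrated (sampled G ω) T
    failure<1⇒concentrated T ω f<1 = record
      { Vol-lower = lower⇒< M≤V (below (≤-trans (x≤x+y (exp-nonNeg _)) (x≤x+y 0≤cd)) )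
      ; Vol-upper = upper⇒< M≤V (below (≤-trans (y≤x+y (exp-nonNeg _)) (x≤x+y 0≤cd)))
      ; δ-lower   = λ ρv≤d → lower⇒< (*-monoˡ-≤ 0≤p ρv≤d) (below (≤-trans (x≤x+y (exp-nonNeg _)) (y≤x+y 0≤ab)))
      ; δ-upper   = upper⇒< (*-monoˡ-≤ 0≤p (y≤x⊔y _ _)) (below (≤-trans (y≤x+y (exp-nonNeg _)) (y≤x+y 0≤ab)))
      }
      where
      x≤x+y : ∀ {x y} → 0# ≤ y → x ≤ x + y
      x≤x+y 0≤y = ≤-by _ 0≤y refl
      y≤x+y : ∀ {x y} → 0# ≤ x → y ≤ x + y
      y≤x+y {x} {y} 0≤x = ≤-by _ 0≤x (solve 2 (λ x y → x :+ y := y :+ x) refl x y)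
      0≤ab = +-nonNeg (exp-nonNeg _) (exp-nonNeg _)
      0≤cd = +-nonNeg (exp-nonNeg _) (exp-nonNeg _)
      below : ∀ {x} → x ≤ failure T ω → x < 1#
      below {x} x≤f = begin-strict
        x            ≤⟨ x≤f ⟩
        failure T ω  <⟨ f<1 ⟩
        1#           ∎
      M≤V : threshold T ≤ p * fromℕ (Vol G T)
      M≤V = *-monoˡ-≤ 0≤p (begin
        ρ * fromℕ (Vol G T)     ≤⟨ *-mono-≤ (proj₁ 0<ρ) (fromℕ-nonNeg (Vol G T)) ρ≤1 ≤-refl ⟩
        1# * fromℕ (Vol G T)    ≈⟨ *-identityˡ _ ⟩
        fromℕ (Vol G T)         ∎)

    𝔼-failure : ∀ T → 𝔼 p (failure T) ≤ fromℕ 4 * exp (- (fromℕ 32 * τ * threshold T))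
    𝔼-failure T = begin
      𝔼 p (failure T)            ≈⟨ trans (𝔼-+ {∣E∣ G} p _ _) (+-cong (𝔼-+ {∣E∣ G} p _ _) (𝔼-+ {∣E∣ G} p _ _)) ⟩
      _                          ≤⟨ +-mono-≤
                                      (+-mono-≤ (𝔼-lower 0≤p p≤1 (incident? T) (edges G)) (𝔼-upper 0≤p p≤1 (incident? T) (edges G) ≤-refl))
                                      (+-mono-≤ (𝔼-lower 0≤p p≤1 (crosses? T) (edges G)) (𝔼-upper 0≤p p≤1 (crosses? T) (edges G) (*-monoˡ-≤ 0≤p (x≤x⊔y _ (ρ * fromℕ (Vol G T)))))) ⟩
      (e + e) + (e + e)          ≈⟨ solve 1 (λ e → e :+ e :+ (e :+ e) := con (+ 4) :* e) refl e ⟩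
      fromℕ 4 * e                ∎
      where e = exp (- (fromℕ 32 * τ * threshold T))

    module _ (Vol-pos : ∀ T → Nonempty T → 0 ℕ.< Vol G T) (x : ℝ)
             (∑-bound : ∑ (nonemptySubsets n) (λ T → exp (- (fromℕ 32 * τ * threshold T))) ≤ x) where

      private
        total : Subset (∣E∣ G) → ℝ
        total ω = ∑ (nonemptySubsets n) (λ T → failure T ω)

        0≤total : ∀ ω → 0# ≤ total ω
        0≤total ω = ∑-nonNeg (nonemptySubsets n) (λ T → failure-nonNeg T ω)

        -- Both sides of a cut are nonempty, so the one sum over nonempty sets controls `S` and
        -- `∁ S` together.
        total<1⇒preserved : ∀ ω → total ω < 1# → AllCutsPreserved ρ G ω
        total<1⇒preserved ω t<1 S (S≢∅ , ∁S≢∅) = concentrated⇒preserved (sampled G ω) S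
          (Vol-pos S S≢∅ , Vol-pos (∁ S) ∁S≢∅) (conc S≢∅) (conc ∁S≢∅)
          where
          conc : ∀ {T} → Nonempty T → Concentrated (sampled G ω) T
          conc {T} T≢∅ = failure<1⇒concentrated T ω (begin-strict
            failure T ω  ≤⟨ ∈⇒≤∑ {f = λ T → failure T ω} (λ T → failure-nonNeg T ω) (nonemptySubsets-complete T≢∅) ⟩
            total ω      <⟨ t<1 ⟩
            1#           ∎)

      -- 1 - `total` is at most 1 everywhere and at most 0 off the event, so its expectation bounds
      -- `Pr` from below. The 4 counts the exponentials in `failure`.
      Pr-allCutsPreserved : 1# - fromℕ 4 * x ≤ Pr p (allCutsPreserved? ρ G)
      Pr-allCutsPreserved = begin
        1# - fromℕ 4 * x
          ≤⟨ ≤-by _ (x≤y⇒0≤y-x 𝔼-total)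
               (solve 2 (λ x t → con (+ 1) :+ (:- con (+ 1)) :* t := con (+ 1) :- con (+ 4) :* x :+ (con (+ 4) :* x :- t)) refl x (𝔼 p total)) ⟩
        1# + (- 1#) * 𝔼 p total
          ≈⟨ trans (𝔼-+ {∣E∣ G} p _ _) (+-cong (𝔼-const {∣E∣ G} p 1#) (𝔼-*ˡ p (- 1#) total)) ⟨
        𝔼 p (λ ω → 1# + (- 1#) * total ω)
          ≤⟨ 𝔼≤Pr 0≤p p≤1 (allCutsPreserved? ρ G) _ ≤1 ≤0 ⟩
        Pr p (allCutsPreserved? ρ G) ∎
        where
        𝔼-total : 𝔼 p total ≤ fromℕ 4 * x
        𝔼-total = begin
          𝔼 p total                                               ≈⟨ 𝔼-∑ p (nonemptySubsets n) failure ⟩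
          ∑ (nonemptySubsets n) (λ T → 𝔼 p (failure T))           ≤⟨ ∑-mono (nonemptySubsets n) 𝔼-failure ⟩
          _                                                       ≈⟨ ∑-*ˡ (nonemptySubsets n) (fromℕ 4) _ ⟩
          _                                                       ≤⟨ *-monoˡ-≤ (fromℕ-nonNeg 4) ∑-bound ⟩
          fromℕ 4 * x                                             ∎
        ≤1 : ∀ ω → 1# + (- 1#) * total ω ≤ 1#
        ≤1 ω = ≤-by (total ω) (0≤total ω)
          (solve 1 (λ t → con (+ 1) := con (+ 1) :+ (:- con (+ 1)) :* t :+ t) refl (total ω))
        ≤0 : ∀ ω → ¬ AllCutsPreserved ρ G ω → 1# + (- 1#) * total ω ≤ 0#
        ≤0 ω ¬e = ≤-by _ (x≤y⇒0≤y-x (≮⇒≥ λ t<1 → ¬e (total<1⇒preserved ω t<1)))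
          (solve 1 (λ t → con (+ 0) := con (+ 1) :+ (:- con (+ 1)) :* t :+ (t :- con (+ 1))) refl (total ω))

-- The choice of the sampling probability

module SamplingBound (R : RealNumbers) where
  open RealNumbers R
  open OrderedField R
  open Probability R
  open Tails R
  open SubsetSums R
  open Concentration R
  open Sampling R
  open Min totalOrder using (x≤y⇒x⊓y≈x; x≤y⇒y⊓x≈x)
  open ≤-Reasoning

  weight-⊤ : ∀ {p} → p ≈ 1# → weight p (⊤ {m}) ≈ 1#
  weight-⊤ {zero}  p≈1 = refl
  weight-⊤ {suc m} p≈1 = trans (*-cong p≈1 (weight-⊤ {m} p≈1)) (*-identityˡ 1#)

  module _ {c κ ρ : ℝ} (0<c : 0# < c) (1≤κ : 1# ≤ κ) (0<ρ : 0# < ρ) (ρ≤1 : ρ ≤ 1#)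
           (n : ℕ) .{{_ : NonZero n}} (G : Multigraph n)
           (κρ≤degree : ∀ v → κ * ρ ≤ fromℕ (degree G v)) where

    private
      L i p q ℓ r : ℝ
      L = ln (fromℕ n)
      i = (ρ * ρ * κ) ⁻¹
      p = samplingProbability c κ ρ n
      q = (fromℕ 12 * c + fromℕ 24) * (1# / (ρ * ρ * κ)) * L
      ℓ = (c + fromℕ 2) * L
      r = exp (- (c * L))

      0<κ : 0# < κ
      0<κ = <-≤-trans 0<1 1≤κ

      0<ρρκ : 0# < ρ * ρ * κ
      0<ρρκ = *-pos (*-pos 0<ρ 0<ρ) 0<κ

      1≤n : 1# ≤ fromℕ n
      1≤n = 1≤fromℕ (ℕ.>-nonZero⁻¹ n)

      0≤L : 0# ≤ L
      0≤L = ln-nonNeg 1≤n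

      0≤q : 0# ≤ q
      0≤q = *-nonNeg (*-nonNeg (+-nonNeg (*-nonNeg (fromℕ-nonNeg 12) (proj₁ 0<c)) (fromℕ-nonNeg 24))
                               (*-nonNeg 0≤1 (⁻¹-nonNeg 0<ρρκ))) 0≤L

      0≤x : 0# ≤ exp (- ℓ)
      0≤x = exp-nonNeg _

      n*n*x≈r : fromℕ n * fromℕ n * exp (- ℓ) ≈ r
      n*n*x≈r = begin-equality
        fromℕ n * fromℕ n * exp (- ℓ)    ≈⟨ *-congʳ (*-cong expL expL) ⟨
        exp L * exp L * exp (- ℓ)        ≈⟨ *-congʳ (exp-+ L L) ⟨
        exp (L + L) * exp (- ℓ)          ≈⟨ exp-+ (L + L) (- ℓ) ⟨
        exp (L + L - ℓ)                  ≈⟨ exp-cong (solve 2 (λ c L → L :+ L :- (c :+ con (+ 2)) :* L := :- (c :* L)) refl c L) ⟩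
        exp (- (c * L))                  ∎
        where
        expL : exp L ≈ fromℕ n
        expL = exp-ln _ (<-≤-trans 0<1 1≤n)

      r≤1 : r ≤ 1#
      r≤1 = begin
        exp (- (c * L))   ≤⟨ exp-mono (≤-by (c * L) (*-nonNeg (proj₁ 0<c) 0≤L) (solve 1 (λ x → con (+ 0) := :- x :+ x) refl (c * L))) ⟩
        exp 0#            ≈⟨ exp-0 ⟩
        1#                ∎

      -- The 2 in `c + fromℕ 2` supplies n² x = r ≤ 1, and n² = 2 (n - 1) + 1 + (n - 1)².
      2[n-1]x≤1 : fromℕ 2 * fromℕ (ℕ.pred n) * exp (- ℓ) ≤ 1#
      2[n-1]x≤1 = begin
        fromℕ 2 * k * exp (- ℓ)            ≤⟨ ≤-by _ (*-nonNeg (+-nonNeg 0≤1 (square-nonNeg k)) 0≤x)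
                                                (solve 2 (λ k x → (con (+ 1) :+ k) :* (con (+ 1) :+ k) :* x := con (+ 2) :* k :* x :+ (con (+ 1) :+ k :* k) :* x) refl k (exp (- ℓ))) ⟩
        (1# + k) * (1# + k) * exp (- ℓ)    ≡⟨ ≡.cong (λ j → fromℕ j * fromℕ j * exp (- ℓ)) (ℕ.suc-pred n) ⟩
        fromℕ n * fromℕ n * exp (- ℓ)      ≈⟨ n*n*x≈r ⟩
        r                                  ≤⟨ r≤1 ⟩
        1#                                 ∎
        where k = fromℕ (ℕ.pred n)

      2nx≤2r : fromℕ 2 * fromℕ n * exp (- ℓ) ≤ fromℕ 2 * r
      2nx≤2r = begin
        fromℕ 2 * fromℕ n * exp (- ℓ)                  ≤⟨ ≤-by _ (*-nonNeg (*-nonNeg (fromℕ-nonNeg 2) (*-nonNeg (fromℕ-nonNeg n) (x≤y⇒0≤y-x 1≤n))) 0≤x)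
                                                            (solve 2 (λ n x → con (+ 2) :* (n :* n :* x) := con (+ 2) :* n :* x :+ con (+ 2) :* (n :* (n :- con (+ 1))) :* x) refl (fromℕ n) (exp (- ℓ))) ⟩
        fromℕ 2 * (fromℕ n * fromℕ n * exp (- ℓ))      ≈⟨ *-congˡ n*n*x≈r ⟩
        fromℕ 2 * r                                    ∎

      ∣T∣κρ≤2Vol : ∀ T → fromℕ ∣ T ∣ * (κ * ρ) ≤ fromℕ 2 * fromℕ (Vol G T)
      ∣T∣κρ≤2Vol T = Vol-≥ G T κρ≤degree

      Vol-pos : ∀ T → Nonempty T → 0 ℕ.< Vol G T
      Vol-pos T (_ , v∈T) = fromℕ-pos⁻¹ (fromℕ-nonNeg (Vol G T) , λ 0≈Vol → ≤⇒≯
        (begin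
          fromℕ ∣ T ∣ * (κ * ρ)       ≤⟨ ∣T∣κρ≤2Vol T ⟩
          fromℕ 2 * fromℕ (Vol G T)   ≈⟨ *-congˡ 0≈Vol ⟨
          fromℕ 2 * 0#                ≈⟨ zeroʳ _ ⟩
          0#                          ∎)
        (*-pos (fromℕ-pos (ℕ.≤-<-trans ℕ.z≤n (x∈p⇒∣p-x∣<∣p∣ v∈T))) (*-pos 0<κ 0<ρ)))

      -- Here 12c + 24 = 6 · 2 · (c + 2): the 6 cancels 32τ = 1/6, and the 2 pays for edges counted
      -- at both ends in the degree sum.
      size≤threshold : ∀ T → p ≈ q → fromℕ ∣ T ∣ * ℓ ≤ fromℕ 32 * τ * (p * (ρ * fromℕ (Vol G T)))
      size≤threshold T p≈q = begin
        k * ℓ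
          ≈⟨ trans (+-congˡ (*-vanish (*-inverse 0<ρρκ) (k * ℓ))) (+-identityʳ _) ⟨
        -- The added term is 0; it tells the solver that `i` is the inverse of ρ²κ.
        k * ℓ + k * ℓ * (ρ * ρ * κ * i - 1#)
          ≤⟨ ≤-by _ (*-nonNeg (*-nonNeg (*-nonNeg 0≤c+2 0≤L) (*-nonNeg (⁻¹-nonNeg 0<ρρκ) (proj₁ 0<ρ))) (x≤y⇒0≤y-x (∣T∣κρ≤2Vol T)))
               (≈-mod-τ (fromℕ 2 * ((c + fromℕ 2) * i * L * ρ * v)) (solve 8 (λ τ c k L i ρ κ v →
                  con (+ 32) :* τ :* ((con (+ 12) :* c :+ con (+ 24)) :* (con (+ 1) :* i) :* L :* (ρ :* v))
                  := k :* ((c :+ con (+ 2)) :* L) :+ k :* ((c :+ con (+ 2)) :* L) :* (ρ :* ρ :* κ :* i :- con (+ 1))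
                     :+ (c :+ con (+ 2)) :* L :* (i :* ρ) :* (con (+ 2) :* v :- k :* (κ :* ρ))
                     :+ con (+ 2) :* ((c :+ con (+ 2)) :* i :* L :* ρ :* v) :* (con (+ 192) :* τ :- con (+ 1)))
                  refl τ c k L i ρ κ v)) ⟩
        fromℕ 32 * τ * (q * (ρ * v))
          ≈⟨ *-congˡ (*-congʳ p≈q) ⟨
        fromℕ 32 * τ * (p * (ρ * v)) ∎
        where
        k = fromℕ ∣ T ∣
        v = fromℕ (Vol G T)
        0≤c+2 : 0# ≤ c + fromℕ 2
        0≤c+2 = +-nonNeg (proj₁ 0<c) (fromℕ-nonNeg 2)

      p<1-case : q ≤ 1# → 1# - fromℕ 8 * r ≤ Pr p (allCutsPreserved? ρ G)
      p<1-case q≤1 = begin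
        1# - fromℕ 8 * r               ≈⟨ solve 1 (λ r → con (+ 1) :- con (+ 8) :* r := con (+ 1) :- con (+ 4) :* (con (+ 2) :* r)) refl r ⟩
        1# - fromℕ 4 * (fromℕ 2 * r)   ≤⟨ Pr-allCutsPreserved 0≤p p≤1 0<ρ ρ≤1 G Vol-pos (fromℕ 2 * r) ∑-bound ⟩
        Pr p (allCutsPreserved? ρ G)   ∎
        where
        p≈q : p ≈ q
        p≈q = x≤y⇒y⊓x≈x q≤1
        0≤p : 0# ≤ p
        0≤p = ≤-trans 0≤q (≤-reflexive (sym p≈q))
        p≤1 : p ≤ 1#
        p≤1 = ≤-trans (≤-reflexive p≈q) q≤1
        ∑-bound : ∑ (nonemptySubsets n) (λ T → exp (- (fromℕ 32 * τ * threshold 0≤p p≤1 0<ρ ρ≤1 G T))) ≤ fromℕ 2 * r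
        ∑-bound = begin
          _                                           ≤⟨ ∑-mono (nonemptySubsets n) (λ T → exp-mono (neg-anti (size≤threshold T p≈q))) ⟩
          ∑ (nonemptySubsets n) (expSize ℓ)           ≤⟨ ∑-nonemptySubsets-≤ ℓ n 2[n-1]x≤1 ⟩
          fromℕ 2 * fromℕ n * exp (- ℓ)               ≤⟨ 2nx≤2r ⟩
          fromℕ 2 * r                                 ∎
          where
          neg-anti : ∀ {x y} → x ≤ y → - y ≤ - x
          neg-anti {x} {y} x≤y = ≤-by _ (x≤y⇒0≤y-x x≤y) (solve 2 (λ x y → :- x := :- y :+ (y :- x)) refl x y)

      p≈1-case : 1# ≤ q → 1# - fromℕ 8 * r ≤ Pr p (allCutsPreserved? ρ G)
      p≈1-case 1≤q = begin
        1# - fromℕ 8 * r                ≤⟨ ≤-by _ (*-nonNeg (fromℕ-nonNeg 8) (exp-nonNeg _)) (solve 1 (λ x → con (+ 1) := con (+ 1) :- x :+ x) refl (fromℕ 8 * r)) ⟩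
        1#                              ≈⟨ weight-⊤ {∣E∣ G} p≈1 ⟨
        weight p (⊤ {∣E∣ G})            ≤⟨ weight≤Pr (≤-trans 0≤1 (≤-reflexive (sym p≈1))) (≤-reflexive p≈1) (allCutsPreserved? ρ G) preserved ⟩
        Pr p (allCutsPreserved? ρ G)    ∎
        where
        p≈1 : p ≈ 1#
        p≈1 = x≤y⇒x⊓y≈x 1≤q
        preserved : AllCutsPreserved ρ G ⊤
        preserved S (S≢∅ , ∁S≢∅) =
          ≡.subst (λ es → ConductancePreserved ρ G (multigraph es) S) (≡.sym (select-⊤ (edges G)))
            (conductancePreserved-refl 0<ρ G S (Vol-pos S S≢∅ , Vol-pos (∁ S) ∁S≢∅))

    sampling-bound : 1# - fromℕ 8 * (1# / (fromℕ n ^ c)) ≤ Pr p (allCutsPreserved? ρ G)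
    sampling-bound = ≤-trans
      -- `fromℕ n ^ c` unfolds to `exp (c * L)`, so its reciprocal is `r`.
      (≤-reflexive (+-congˡ (-‿cong (*-congˡ (1/exp (c * L))))))
      (bound (≤-total 1# q))
      where
      bound : 1# ≤ q ⊎ q ≤ 1# → 1# - fromℕ 8 * r ≤ Pr p (allCutsPreserved? ρ G)
      bound (inj₁ 1≤q) = p≈1-case 1≤q
      bound (inj₂ q≤1) = p<1-case q≤1

lemma20 : (R : RealNumbers) →
    let open RealNumbers R
        open Sampling R
    in
    ∃ λ (K : ℝ) →
      (c κ ρ : ℝ) → 0# < c → 1# ≤ κ → 0# < ρ → ρ ≤ 1# →
      (n : ℕ) .{{_ : NonZero n}} (G : Multigraph n) →
      (∀ v → κ * ρ ≤ fromℕ (degree G v)) →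
      1# - K * (1# / (fromℕ n ^ c))
        ≤ Pr (samplingProbability c κ ρ n) (allCutsPreserved? ρ G)
-- 8 = 4 · 2: four exponentials per vertex set, times the 2 in the bound on the sum over sets. It is
-- fixed before c, κ and ρ, so the constant is uniform in them.
lemma20 R = RealNumbers.fromℕ R 8 ,
  λ c κ ρ 0<c 1≤κ 0<ρ ρ≤1 n G deg → SamplingBound.sampling-bound R 0<c 1≤κ 0<ρ ρ≤1 n G deg
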